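{- Let $q=2^n$ with $n\ge 3$, let $h$ be a positive integer with $\gcd(n,h)=1$, and let $\mathcal A\subset\mathrm{PG}(3,q)$ and the classes of planes $\mathcal O_d^{\mathfrak s}$, $d\in\{0,1,2,3,q+1\}$, be as defined in the context. Through every point of $\mathcal A$ there pass exactly $r_{q+1,d}$ planes of $\mathcal O_d^{\mathfrak s}$, where $$r_{q+1,d}=\begin{cases}1&\text{if } d=q+1,\\ 0&\text{if } d=0,\\ \frac{q(q-1)}2&\text{if } d\in\{1,3\},\\ 2q&\text{if } d=2.\end{cases}$$
   Context: Points of $\mathrm{PG}(3,q)$ have homogeneous coordinates $(X_1,X_2,X_3,X_4)$; $U_i$ is the point with $1$ in position $i$ and $0$ elsewhere. $\mathcal A=\{P_t=(1,t,t^{2^h},t^{2^h+1})\mid t\in\mathbb F_q\}\cup\{U_4\}$. $\mathfrak s$ is the symplectic polarity of $\mathrm{PG}(3,q)$ defined by the alternating form $x_1y_4+x_2y_3+x_3y_2+x_4y_1$. The osculating planes are the $q+1$ planes $P^{\mathfrak s}$, $P\in\mathcal A$. Put $\mathcal O_{q+1}=\mathcal A$; for $i\in\{0,1,2,3\}$, $\mathcal O_i$ is the set of points of $\mathrm{PG}(3,q)\setminus\mathcal A$ lying on exactly $i$ osculating planes. For $i\in\{0,1,2,3,q+1\}$, $\mathcal O_i^{\mathfrak s}=\{P^{\mathfrak s}\mid P\in\mathcal O_i\}$ (so $\mathcal O_{q+1}^{\mathfrak s}$ is the set of osculating planes). -}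

module Defs where

open import Algebra.Bundles using (CommutativeRing)
open import Data.Fin using (Fin; toℕ)
open import Data.Fin.Patterns using (0F; 1F; 2F; 3F)
open import Data.Nat as ℕ using (ℕ; _∸_)
import Data.Nat.DivMod as ℕ
open import Data.Product using (∃; _×_; _,_; proj₁)
open import Data.Sum using (_⊎_)
open import Data.Vec.Functional using (Vector; _∷_; []; replicate; updateAt)
open import Data.Vec.Functional.Properties using (updateAt-updates)
open import Function using (const; Inverse)
open import Level using (_⊔_; suc)
open import Relation.Binary using (Setoid)
import Relation.Binary.Construct.On as On
import Relation.Binary.PropositionalEquality as ≡
open import Relation.Nullary using (¬_)
open import Relation.Unary using (Pred; _∈_; _∉_)

HasCardinality : ∀ {a ℓ} → Setoid a ℓ → ℕ → Set (a ⊔ ℓ)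
HasCardinality S k = Inverse S (≡.setoid (Fin k))

-- Elements of the subset are identified by the equality of S alone; the
-- membership proofs are ignored.
subset : ∀ {a ℓ p} (S : Setoid a ℓ) → Pred (Setoid.Carrier S) p → Setoid (a ⊔ p) ℓ
subset S Q = On.setoid S (proj₁ {B = Q})

record Field c ℓ : Set (suc (c ⊔ ℓ)) where
  field
    commutativeRing : CommutativeRing c ℓ
  open CommutativeRing commutativeRing public
  field
    1≉0        : ¬ (1# ≈ 0#)
    invertible : ∀ x → ¬ (x ≈ 0#) → ∃ λ y → x * y ≈ 1#

-- The index set {0,1,2,3,q+1} of the classes.
data Class : Set where
  #   : Fin 4 → Class
  q+1 : Class

module PG3 {c ℓ} (K : Field c ℓ) where

  open Field K
  open import Algebra.Properties.Monoid.Sum +-monoid using (sum)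
  open import Relation.Binary.Reasoning.Setoid setoid

  -- Homogeneous coordinates; the same type serves for points and, as
  -- coefficients of linear forms, for planes.
  record Homogeneous : Set (c ⊔ ℓ) where
    constructor ⟨_,_⟩
    field
      coord   : Vector Carrier 4
      nonzero : ¬ (∀ i → coord i ≈ 0#)
  open Homogeneous public

  _∼_ : Homogeneous → Homogeneous → Set (c ⊔ ℓ)
  x ∼ y = ∃ λ k → ¬ (k ≈ 0#) × (∀ i → coord x i ≈ k * coord y i)

  private
    ∼-refl : ∀ {x} → x ∼ x
    ∼-refl = 1# , 1≉0 , λ i → sym (*-identityˡ _)

    ∼-sym : ∀ {x y} → x ∼ y → y ∼ x
    ∼-sym {x} {y} (k , k≉0 , x≈ky) with invertible k k≉0
    ... | l , kl≈1 = l , l≉0 , λ i → begin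
      coord y i              ≈⟨ *-identityˡ _ ⟨
      1# * coord y i         ≈⟨ *-congʳ (trans (*-comm l k) kl≈1) ⟨
      (l * k) * coord y i    ≈⟨ *-assoc l k _ ⟩
      l * (k * coord y i)    ≈⟨ *-congˡ (x≈ky i) ⟨
      l * coord x i          ∎
      where
      l≉0 : ¬ (l ≈ 0#)
      l≉0 l≈0 = 1≉0 (trans (sym kl≈1) (trans (*-congˡ l≈0) (zeroʳ k)))

    ∼-trans : ∀ {x y z} → x ∼ y → y ∼ z → x ∼ z
    ∼-trans {x} {y} {z} (k , _ , x≈ky) (l , _ , y≈lz) = k * l , kl≉0 , x≈klz
      where
      x≈klz : ∀ i → coord x i ≈ (k * l) * coord z i
      x≈klz i = trans (x≈ky i) (trans (*-congˡ (y≈lz i)) (sym (*-assoc k l _)))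
      kl≉0 : ¬ (k * l ≈ 0#)
      kl≉0 kl≈0 = nonzero x λ i → trans (x≈klz i) (trans (*-congʳ kl≈0) (zeroˡ _))

  projective : Setoid (c ⊔ ℓ) (c ⊔ ℓ)
  projective = record
    { Carrier       = Homogeneous
    ; _≈_           = _∼_
    ; isEquivalence = record
      { refl  = λ {x} → ∼-refl {x}
      ; sym   = λ {x} {y} → ∼-sym {x} {y}
      ; trans = λ {x} {y} {z} → ∼-trans {x} {y} {z}
      }
    }

  Points Planes : Setoid (c ⊔ ℓ) (c ⊔ ℓ)
  Points = projective
  Planes = projective

  Point Plane : Set (c ⊔ ℓ)
  Point = Setoid.Carrier Points
  Plane = Setoid.Carrier Planes

  _LiesOn_ : Point → Plane → Set ℓ
  P LiesOn π = sum (λ i → coord π i * coord P i) ≈ 0#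

  Exactly_PlanesOf_Through_ : ∀ {p} → ℕ → Pred Plane p → Point → Set (c ⊔ ℓ ⊔ p)
  Exactly k PlanesOf Q Through P =
    HasCardinality (subset Planes (λ π → π ∈ Q × P LiesOn π)) k

  e : Fin 4 → Vector Carrier 4
  e i = updateAt (replicate 4 0#) i (const 1#)

  -- The point U_{i+1}: Fin 4 counts from 0.
  U : Fin 4 → Point
  U i = ⟨ e i , (λ e≈0 → 1≉0 (trans (reflexive (≡.sym (updateAt-updates i (replicate 4 0#)))) (e≈0 i))) ⟩

  form : Vector Carrier 4 → Vector Carrier 4 → Carrier
  form x y = x 0F * y 3F + x 1F * y 2F + x 2F * y 1F + x 3F * y 0F

  private
    sel₀ : ∀ a b c d → a * 1# + b * 0# + c * 0# + d * 0# ≈ a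
    sel₀ a b c d =
      trans (+-cong (+-cong (+-cong (*-identityʳ a) (zeroʳ b)) (zeroʳ c)) (zeroʳ d))
      (trans (+-identityʳ _) (trans (+-identityʳ _) (+-identityʳ _)))

    sel₁ : ∀ a b c d → a * 0# + b * 1# + c * 0# + d * 0# ≈ b
    sel₁ a b c d = trans (+-congʳ (+-congʳ (+-comm _ _))) (sel₀ b a c d)

    sel₂ : ∀ a b c d → a * 0# + b * 0# + c * 1# + d * 0# ≈ c
    sel₂ a b c d = trans (+-congʳ (trans (+-comm _ _) (sym (+-assoc _ _ _)))) (sel₀ c a b d)

    sel₃ : ∀ a b c d → a * 0# + b * 0# + c * 0# + d * 1# ≈ d
    sel₃ a b c d =
      trans (+-comm _ _) (trans (sym (+-assoc _ _ _)) (trans (+-congʳ (sym (+-assoc _ _ _))) (sel₀ d a b c)))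

  -- P^𝔰 is the plane of all Y with form P Y = 0; the coefficients of the linear
  -- form y ↦ form P y are its values at the basis vectors.
  _^𝔰 : Point → Plane
  P ^𝔰 = ⟨ (λ j → form (coord P) (e j)) , nz ⟩
    where
    x = coord P
    nz : ¬ (∀ j → form x (e j) ≈ 0#)
    nz f≈0 = nonzero P λ where
      0F → trans (sym (sel₀ (x 0F) (x 1F) (x 2F) (x 3F))) (f≈0 3F)
      1F → trans (sym (sel₁ (x 0F) (x 1F) (x 2F) (x 3F))) (f≈0 2F)
      2F → trans (sym (sel₂ (x 0F) (x 1F) (x 2F) (x 3F))) (f≈0 1F)
      3F → trans (sym (sel₃ (x 0F) (x 1F) (x 2F) (x 3F))) (f≈0 0F)

  ^𝔰-form : ∀ P Y → sum (λ i → coord (P ^𝔰) i * coord Y i) ≈ form (coord P) (coord Y)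
  ^𝔰-form P Y = begin
    form x (e 0F) * y 0F + (form x (e 1F) * y 1F + (form x (e 2F) * y 2F + (form x (e 3F) * y 3F + 0#)))
      ≈⟨ +-cong (*-congʳ (sel₃ _ _ _ _)) (+-cong (*-congʳ (sel₂ _ _ _ _))
           (+-cong (*-congʳ (sel₁ _ _ _ _)) (trans (+-identityʳ _) (*-congʳ (sel₀ _ _ _ _))))) ⟩
    x 3F * y 0F + (x 2F * y 1F + (x 1F * y 2F + x 0F * y 3F))
      ≈⟨ +-comm _ _ ⟩
    x 2F * y 1F + (x 1F * y 2F + x 0F * y 3F) + x 3F * y 0F
      ≈⟨ +-congʳ (trans (+-comm _ _) (+-congʳ (+-comm _ _))) ⟩
    form x y ∎
    where
    x = coord P
    y = coord Y

  -- The image of a set of points under 𝔰.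
  _ˢ : ∀ {p} → Pred Point p → Pred Plane (c ⊔ ℓ ⊔ p)
  (S ˢ) π = ∃ λ P → P ∈ S × π ∼ (P ^𝔰)

  module Arc (h : ℕ) where

    open import Algebra.Properties.Semiring.Exp semiring using (_^_)

    P[_] : Carrier → Point
    P[ t ] = ⟨ 1# ∷ t ∷ t ^ (2 ℕ.^ h) ∷ t ^ (2 ℕ.^ h ℕ.+ 1) ∷ [] , (λ p≈0 → 1≉0 (p≈0 0F)) ⟩

    𝒜 : Pred Point (c ⊔ ℓ)
    𝒜 P = (∃ λ t → P ∼ P[ t ]) ⊎ P ∼ U 3F

    Osculating : Pred Plane (c ⊔ ℓ)
    Osculating = 𝒜 ˢ

    𝒪 : Class → Pred Point (c ⊔ ℓ)
    𝒪 (# i) P = P ∉ 𝒜 × Exactly toℕ i PlanesOf Osculating Through P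
    𝒪 q+1   P = P ∈ 𝒜

r[q+1,_] : Class → ℕ → ℕ
r[q+1, q+1  ] q = 1
r[q+1, # 0F ] q = 0
r[q+1, # 1F ] q = q ℕ.* (q ∸ 1) ℕ./ 2
r[q+1, # 2F ] q = 2 ℕ.* q
r[q+1, # 3F ] q = q ℕ.* (q ∸ 1) ℕ./ 2

{-# OPTIONS --safe #-}
module Submission where

-- The polarity turns the planes of 𝒪 d ˢ through P into the points of 𝒪 d on the
-- plane P^𝔰, and isometries of the form preserving 𝒜 move P to U₄, whose plane is
-- X₁ = 0. Write σ t = t^(2^h). Since gcd(n,h) = 1, the fixed field of σ is {0,1}, so
-- v ↦ σ v / v permutes the nonzero elements and the points of X₁ = 0 other than U₄ are
-- (0,0,1,y), (0,1,0,y) and (0,σ v,v,w) with v ≠ 0. Besides U₄^𝔰, the point (0,a,b,y)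
-- lies on one osculating plane for each t with σ t a + t b = y: a single t for the first
-- two families, and for the third the solutions of ℘ (t v) = w with ℘ u = σ u + u. This
-- additive map has kernel {0,1}, so half of the w have two solutions and half have none.

open import Defs
open import Algebra.Bundles using (AbelianGroup)
open import Data.Empty using (⊥-elim)
open import Data.Fin using (Fin; zero; suc; toℕ; opposite; punchOut; _≟_)
open import Data.Fin.Patterns using (0F; 1F; 2F; 3F)
import Data.Fin.Permutation as Perm
import Data.Fin.Properties as Fin
open import Data.Nat as ℕ using (ℕ; _≤_)
import Data.Nat.DivMod as ℕ
open import Data.Nat.GCD using (gcd; gcd-GCD; module Bézout)
import Data.Nat.Properties as ℕ
open import Data.Product using (∃; ∃₂; _×_; _,_; proj₁; proj₂)
open import Data.Product.Function.NonDependent.Setoid using (_×-inverse_)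
open import Data.Product.Relation.Binary.Pointwise.NonDependent as × using (×-setoid)
open import Data.Sum using (_⊎_; inj₁; inj₂)
open import Data.Sum.Function.Setoid using (_⊎-inverse_)
open import Data.Sum.Relation.Binary.Pointwise as ⊎ using (⊎-setoid)
open import Data.Vec.Functional using (Vector; _∷_; [])
open import Function using (Inverse; Injection; _∘_; id)
open import Function.Properties.Bijection using (Bijection⇒Inverse)
import Function.Properties.Inverse as Inv
open import Level using (Level; _⊔_)
open import Relation.Binary using (Setoid; Decidable)
import Relation.Binary.PropositionalEquality as ≡
open import Relation.Binary.PropositionalEquality using (_≡_)
open import Relation.Nullary using (¬_; Dec; yes; no)
import Relation.Nullary.Decidable as Dec
import Relation.Unary as U
open import Relation.Unary using (Pred; ∁; _∈_; _∉_)

-- The classes are defined by counting planes, so nothing says in advance that they are disjoint or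
-- which of them a given point of U₄^𝔰 belongs to. Disjointness comes from the uniqueness of
-- cardinalities, membership is computed for every normal form on U₄^𝔰, and the two together
-- identify the classes there. The normal form (0,σ v,v,w) is chosen because the unknown t then
-- enters only through t v, as σ t σ v + t v = ℘ (t v): the class depends on w and not on v, which
-- gives (q-1) times q/2 points. It is unique because rescaling by k keeps the shape (σ v,v) only if
-- σ k = k, that is k = 1. The cardinality of K is the source of decidable equality, of
-- characteristic 2 and of x^q = x.

-- Cardinalities of setoids and counting by bijections

module Cardinality where

  private variable
    a b ℓ₁ ℓ₂ p q : Level
    k l m n : ℕ

  module _ {S : Setoid a ℓ₁} {T : Setoid b ℓ₂} (I : Inverse S T) where

    to-injective : ∀ {x y} → Setoid._≈_ T (Inverse.to I x) (Inverse.to I y) → Setoid._≈_ S x y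
    to-injective = Injection.injective (Inv.Inverse⇒Injection I)

    from-injective : ∀ {x y} → Setoid._≈_ S (Inverse.from I x) (Inverse.from I y) → Setoid._≈_ T x y
    from-injective = Injection.injective (Inv.Inverse⇒Injection (Inv.sym I))

  module _ (S : Setoid a ℓ₁) (T : Setoid b ℓ₂) where
    private
      module S = Setoid S
      module T = Setoid T

    bijective⇒Inverse : (f : S.Carrier → T.Carrier) →
      (∀ {x y} → x S.≈ y → f x T.≈ f y) →
      (∀ {x y} → f x T.≈ f y → x S.≈ y) →
      (∀ y → ∃ λ x → f x T.≈ y) → Inverse S T
    bijective⇒Inverse f cong injective surjective = Bijection⇒Inverse record
      { to        = f
      ; cong      = cong
      ; bijective = injective , λ y → proj₁ (surjective y) , λ z≈ → T.trans (cong z≈) (proj₂ (surjective y))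
      }

    -- Equality in `subset` ignores membership proofs, so the two implications need no coherence
    -- with each other.
    subset-inverse : {P : Pred S.Carrier p} {Q : Pred T.Carrier q} (I : Inverse S T) →
      (∀ {x} → P x → Q (Inverse.to I x)) → (∀ {y} → Q y → P (Inverse.from I y)) →
      Inverse (subset S P) (subset T Q)
    subset-inverse I P⇒Q Q⇒P = record
      { to        = λ (x , Px) → I.to x , P⇒Q Px
      ; from      = λ (y , Qy) → I.from y , Q⇒P Qy
      ; to-cong   = I.to-cong
      ; from-cong = I.from-cong
      ; inverse   = I.inverseˡ , I.inverseʳ
      }
      where module I = Inverse I

  subset-cong : (S : Setoid a ℓ₁) {P : Pred (Setoid.Carrier S) p} {Q : Pred (Setoid.Carrier S) q} →
    (∀ {x} → P x → Q x) → (∀ {x} → Q x → P x) → Inverse (subset S P) (subset S Q)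
  subset-cong S = subset-inverse S S (Inv.refl S)

  module _ (S : Setoid a ℓ₁) where
    private module S = Setoid S

    enumeration : (f : Fin k → S.Carrier) → (∀ {i j} → f i S.≈ f j → i ≡ j) →
      (∀ x → ∃ λ i → f i S.≈ x) → HasCardinality S k
    enumeration f injective surjective =
      Inv.sym (bijective⇒Inverse (≡.setoid _) S f (S.reflexive ∘ ≡.cong f) injective surjective)

    cardinality-zero : (∀ x → ¬ (x S.≈ x)) → HasCardinality S 0
    cardinality-zero ¬x = enumeration (λ ()) (λ {}) (λ x → ⊥-elim (¬x x S.refl))

    cardinality-one : ∀ x → (∀ y → x S.≈ y) → HasCardinality S 1
    cardinality-one x unique = enumeration (λ _ → x) (λ { {zero} {zero} _ → ≡.refl ; {suc ()} ; {zero} {suc ()} }) (λ y → zero , unique y)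

    cardinality-two : ∀ x y → ¬ (x S.≈ y) → (∀ z → x S.≈ z ⊎ y S.≈ z) → HasCardinality S 2
    cardinality-two x y x≉y cover = enumeration f injective surjective
      where
      f : Fin 2 → S.Carrier
      f zero    = x
      f (suc _) = y
      injective : ∀ {i j} → f i S.≈ f j → i ≡ j
      injective {zero}     {zero}     _   = ≡.refl
      injective {zero}     {suc zero} x≈y = ⊥-elim (x≉y x≈y)
      injective {suc zero} {zero}     y≈x = ⊥-elim (x≉y (S.sym y≈x))
      injective {suc zero} {suc zero} _   = ≡.refl
      surjective : ∀ z → ∃ λ i → f i S.≈ z
      surjective z with cover z
      ... | inj₁ x≈z = zero , x≈z
      ... | inj₂ y≈z = suc zero , y≈z

  module _ {S : Setoid a ℓ₁} where
    private module S = Setoid S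

    -- Two numberings compose to an injection of `Fin k` into `Fin l` and to one in the other
    -- direction.
    cardinality-unique : HasCardinality S k → HasCardinality S l → k ≡ l
    cardinality-unique I J = ℕ.≤-antisym (below I J) (below J I)
      where
      below : ∀ {k l} → HasCardinality S k → HasCardinality S l → k ≤ l
      below I J = Fin.injective⇒≤ (to-injective (Inv.trans (Inv.sym I) J))

    cardinality-zero⇒empty : HasCardinality S 0 → ¬ S.Carrier
    cardinality-zero⇒empty I x with () ← Inverse.to I x

    module _ {T : Setoid b ℓ₂} where

      cardinality-⊎ : HasCardinality S k → HasCardinality T l → HasCardinality (⊎-setoid S T) (k ℕ.+ l)
      cardinality-⊎ I J =
        Inv.trans (I ⊎-inverse J) (Inv.trans (⊎.Pointwise-≡↔≡ _ _) (Inv.sym Fin.+↔⊎))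

      cardinality-× : HasCardinality S k → HasCardinality T l → HasCardinality (×-setoid S T) (k ℕ.* l)
      cardinality-× I J =
        Inv.trans (I ×-inverse J) (Inv.trans ×.Pointwise-≡↔≡ (Inv.sym Fin.*↔×))

  -- Pigeonhole: if `j` were missed, punching it out of the codomain would inject `Fin (suc n)` into
  -- `Fin n`.
  injective⇒surjective : (f : Fin n → Fin n) → (∀ {i j} → f i ≡ f j → i ≡ j) → ∀ j → ∃ λ i → f i ≡ j
  injective⇒surjective {ℕ.suc n} f injective j with Fin.any? (λ i → f i ≟ j)
  ... | yes found = found
  ... | no missed = ⊥-elim (ℕ.1+n≰n (Fin.injective⇒≤ {f = λ i → punchOut (avoids i)}
                      (λ {i} {i′} eq → injective (Fin.punchOut-injective (avoids i) (avoids i′) eq))))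
    where
    avoids : ∀ i → ¬ (j ≡ f i)
    avoids i j≡fi = missed (i , ≡.sym j≡fi)

  Split : ∀ {S : Setoid a ℓ₁} → Pred (Setoid.Carrier S) p → ℕ → Set _
  Split {S = S} P n = ∃₂ λ k l → k ℕ.+ l ≡ n × HasCardinality (subset S P) k × HasCardinality (subset S (∁ P)) l

  module _ {P : Pred (Fin (ℕ.suc n)) p} where

    extend-yes : P zero → HasCardinality (subset (≡.setoid (Fin n)) (P ∘ suc)) k →
      HasCardinality (subset (≡.setoid (Fin (ℕ.suc n))) P) (ℕ.suc k)
    extend-yes P0 I = enumeration _ f injective surjective
      where
      module I = Inverse I
      f : Fin (ℕ.suc _) → ∃ P
      f zero    = zero , P0
      f (suc i) = suc (proj₁ (I.from i)) , proj₂ (I.from i)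
      injective : ∀ {i j} → proj₁ (f i) ≡ proj₁ (f j) → i ≡ j
      injective {zero}  {zero}  _  = ≡.refl
      injective {zero}  {suc j} ()
      injective {suc i} {zero}  ()
      injective {suc i} {suc j} eq = ≡.cong suc (from-injective I (Fin.suc-injective eq))
      surjective : ∀ (x : ∃ P) → ∃ λ i → proj₁ (f i) ≡ proj₁ x
      surjective (zero  , _)  = zero , ≡.refl
      surjective (suc j , Pj) = suc (I.to (j , Pj)) , ≡.cong suc (I.strictlyInverseʳ (j , Pj))

    extend-no : ¬ P zero → HasCardinality (subset (≡.setoid (Fin n)) (P ∘ suc)) k →
      HasCardinality (subset (≡.setoid (Fin (ℕ.suc n))) P) k
    extend-no ¬P0 I = enumeration _ f
      (λ eq → from-injective I (Fin.suc-injective eq)) surjective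
      where
      module I = Inverse I
      f : Fin _ → ∃ P
      f i = suc (proj₁ (I.from i)) , proj₂ (I.from i)
      surjective : ∀ (x : ∃ P) → ∃ λ i → proj₁ (f i) ≡ proj₁ x
      surjective (zero  , P0) = ⊥-elim (¬P0 P0)
      surjective (suc j , Pj) = I.to (j , Pj) , ≡.cong suc (I.strictlyInverseʳ (j , Pj))

  splitFin : {P : Pred (Fin n) p} → U.Decidable P → Split {S = ≡.setoid (Fin n)} P n
  splitFin {ℕ.zero} P? = 0 , 0 , ≡.refl , cardinality-zero _ (λ ()) , cardinality-zero _ (λ ())
  splitFin {ℕ.suc n} P? with splitFin (P? ∘ suc) | P? zero
  ... | k , l , k+l≡n , I , J | yes P0 =
    ℕ.suc k , l , ≡.cong ℕ.suc k+l≡n , extend-yes P0 I , extend-no (λ ¬P0 → ¬P0 P0) J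
  ... | k , l , k+l≡n , I , J | no ¬P0 =
    k , ℕ.suc l , ≡.trans (ℕ.+-suc k l) (≡.cong ℕ.suc k+l≡n) , extend-no ¬P0 I , extend-yes ¬P0 J

  module Finite {S : Setoid a ℓ₁} (I : HasCardinality S n) where
    private
      module S = Setoid S
      module I = Inverse I

    _≈?_ : Decidable S._≈_
    x ≈? y = Dec.map′ (to-injective I) I.to-cong (I.to x ≟ I.to y)

    -- The search runs over indices, and the numbering returns an element only up to `≈`; hence `P`
    -- has to respect equality.
    ∃? : {P : Pred S.Carrier p} → (∀ {x y} → x S.≈ y → P x → P y) → U.Decidable P → Dec (∃ P)
    ∃? resp P? = Dec.map′ (λ (i , Pi) → I.from i , Pi)
      (λ (x , Px) → I.to x , resp (S.sym (I.strictlyInverseʳ x)) Px) (Fin.any? (P? ∘ I.from))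

    split : {P : Pred S.Carrier p} → (∀ {x y} → x S.≈ y → P x → P y) → U.Decidable P → Split {S = S} P n
    split {P = P} resp P? =
      let k , l , k+l≡n , J , J′ = splitFin (P? ∘ I.from)
      in k , l , k+l≡n ,
         Inv.trans (subset-inverse S (≡.setoid _) I (resp (S.sym (I.strictlyInverseʳ _))) id) J ,
         Inv.trans (subset-inverse S (≡.setoid _) I (λ ¬Px → ¬Px ∘ resp (I.strictlyInverseʳ _)) id) J′

    injective⇒surjective-on : (f : S.Carrier → S.Carrier) → (∀ {x y} → x S.≈ y → f x S.≈ f y) →
      (∀ {x y} → f x S.≈ f y → x S.≈ y) → ∀ y → ∃ λ x → f x S.≈ y
    injective⇒surjective-on f cong injective y =
      let i , eq = injective⇒surjective (I.to ∘ f ∘ I.from)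
                     (λ eq → from-injective I (injective (to-injective I eq))) (I.to y)
      in I.from i , to-injective I eq

  -- The product of all elements is unchanged when every factor is multiplied by x.
  module _ (G : AbelianGroup a ℓ₁) (I : HasCardinality (AbelianGroup.setoid G) n) where
    open AbelianGroup G
    open import Algebra.Properties.Group group using (∙-cancelʳ)
    open import Algebra.Properties.CommutativeMonoid.Sum commutativeMonoid
    open import Algebra.Properties.Monoid.Mult monoid renaming (_×_ to _·_)
    open import Relation.Binary.Reasoning.Setoid setoid
    private module I = Inverse I

    order-annihilates : ∀ x → n · x ≈ ε
    order-annihilates x = ∙-cancelʳ (sum I.from) _ _ (begin
      n · x ∙ sum I.from                         ≈⟨ ∙-congʳ (sum-replicate n) ⟨
      sum (λ (_ : Fin n) → x) ∙ sum I.from       ≈⟨ ∑-distrib-+ (λ _ → x) I.from ⟨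
      sum (λ i → x ∙ I.from i)                   ≈⟨ sum-cong-≋ (λ i → sym (I.strictlyInverseʳ (x ∙ I.from i))) ⟩
      sum (λ i → I.from (shift Perm.⟨$⟩ʳ i))     ≈⟨ sum-permute I.from shift ⟨
      sum I.from                                 ≈⟨ identityˡ _ ⟨
      ε ∙ sum I.from                             ∎)
      where
      translate : Inverse setoid setoid
      translate = record
        { to = x ∙_ ; from = x ⁻¹ ∙_ ; to-cong = ∙-congˡ ; from-cong = ∙-congˡ
        ; inverse = (λ {y} {z} z≈ → trans (∙-congˡ z≈) (trans (sym (assoc _ _ _)) (trans (∙-congʳ (inverseʳ x)) (identityˡ y))))
                  , (λ {y} {z} z≈ → trans (∙-congˡ z≈) (trans (sym (assoc _ _ _)) (trans (∙-congʳ (inverseˡ x)) (identityˡ y))))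
        }
      shift : Perm.Permutation n n
      shift = Inv.trans (Inv.sym I) (Inv.trans translate I)

open Cardinality

-- The `/ 2` of the statement truncates, so q(q-1) is first written as a visible multiple of 2.
half-product : ∀ {m q} → m ℕ.* 2 ≡ q → (q ℕ.∸ 1) ℕ.* m ≡ q ℕ.* (q ℕ.∸ 1) ℕ./ 2
half-product {m} {q} m*2≡q = ≡.sym (≡.trans (≡.cong (ℕ._/ 2) (begin
  q ℕ.* (q ℕ.∸ 1)            ≡⟨ ℕ.*-comm q _ ⟩
  (q ℕ.∸ 1) ℕ.* q            ≡⟨ ≡.cong ((q ℕ.∸ 1) ℕ.*_) m*2≡q ⟨
  (q ℕ.∸ 1) ℕ.* (m ℕ.* 2)    ≡⟨ ℕ.*-assoc (q ℕ.∸ 1) m 2 ⟨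
  (q ℕ.∸ 1) ℕ.* m ℕ.* 2      ∎)) (ℕ.m*n/n≡m ((q ℕ.∸ 1) ℕ.* m) 2))
  where open ≡.≡-Reasoning

-- Finite fields and their Frobenius automorphisms

module FieldProperties {c ℓ} (K : Field c ℓ) where
  open Field K
  open import Algebra.Solver.Ring.NaturalCoefficients.Default commutativeSemiring
  open import Relation.Binary.Reasoning.Setoid setoid

  Nonzero : Pred Carrier ℓ
  Nonzero x = ¬ (x ≈ 0#)

  inverse-unique : ∀ {x y z} → x * y ≈ 1# → x * z ≈ 1# → y ≈ z
  inverse-unique {x} {y} {z} xy≈1 xz≈1 = begin
    y            ≈⟨ *-identityʳ y ⟨
    y * 1#       ≈⟨ *-congˡ xz≈1 ⟨
    y * (x * z)  ≈⟨ *-assoc y x z ⟨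
    y * x * z    ≈⟨ *-congʳ (trans (*-comm y x) xy≈1) ⟩
    1# * z       ≈⟨ *-identityˡ z ⟩
    z            ∎

  *-cancelˡ : ∀ {x y z} → Nonzero x → x * y ≈ x * z → y ≈ z
  *-cancelˡ {x} {y} {z} x≉0 xy≈xz with invertible x x≉0
  ... | x⁻¹ , xx⁻¹≈1 = begin
    y              ≈⟨ cancel y ⟨
    x⁻¹ * (x * y)  ≈⟨ *-congˡ xy≈xz ⟩
    x⁻¹ * (x * z)  ≈⟨ cancel z ⟩
    z              ∎
    where
    cancel : ∀ w → x⁻¹ * (x * w) ≈ w
    cancel w = trans (sym (*-assoc _ _ _)) (trans (*-congʳ (trans (*-comm _ _) xx⁻¹≈1)) (*-identityˡ w))

  nonzero-factor : ∀ {x y} → Nonzero x → x * y ≈ 0# → y ≈ 0#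
  nonzero-factor x≉0 xy≈0 = *-cancelˡ x≉0 (trans xy≈0 (sym (zeroʳ _)))

  *-nonzero : ∀ {x y} → Nonzero x → Nonzero y → Nonzero (x * y)
  *-nonzero x≉0 y≉0 xy≈0 = y≉0 (nonzero-factor x≉0 xy≈0)

  unit-nonzero : ∀ {x y} → x * y ≈ 1# → Nonzero y
  unit-nonzero xy≈1 y≈0 = 1≉0 (trans (sym xy≈1) (trans (*-congˡ y≈0) (zeroʳ _)))

  Unit : Set _
  Unit = ∃ Nonzero

  unitSetoid : Setoid _ _
  unitSetoid = subset setoid Nonzero

  _⁻¹ : Unit → Carrier
  (x , x≉0) ⁻¹ = proj₁ (invertible x x≉0)

  ⁻¹-inverseʳ : (u : Unit) → proj₁ u * u ⁻¹ ≈ 1#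
  ⁻¹-inverseʳ (x , x≉0) = proj₂ (invertible x x≉0)

  ⁻¹-inverseˡ : (u : Unit) → u ⁻¹ * proj₁ u ≈ 1#
  ⁻¹-inverseˡ u = trans (*-comm _ _) (⁻¹-inverseʳ u)

  ⁻¹-nonzero : (u : Unit) → Nonzero (u ⁻¹)
  ⁻¹-nonzero u = unit-nonzero (⁻¹-inverseʳ u)

  *-⁻¹-cancelˡ : (u : Unit) → ∀ y → proj₁ u * (u ⁻¹ * y) ≈ y
  *-⁻¹-cancelˡ u y = trans (sym (*-assoc _ _ _)) (trans (*-congʳ (⁻¹-inverseʳ u)) (*-identityˡ y))

  cross-multiply : (u v : Unit) → ∀ {x y} → x * u ⁻¹ ≈ y * v ⁻¹ → x * proj₁ v ≈ y * proj₁ u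
  cross-multiply u′@(u , _) v′@(v , _) {x} {y} eq = begin
    x * v                      ≈⟨ *-congˡ (*-⁻¹-cancelˡ u′ v) ⟨
    x * (u * (u′ ⁻¹ * v))      ≈⟨ solve 4 (λ x u i v → x :* (u :* (i :* v)) := (x :* i) :* (v :* u)) refl x u (u′ ⁻¹) v ⟩
    (x * u′ ⁻¹) * (v * u)      ≈⟨ *-congʳ eq ⟩
    (y * v′ ⁻¹) * (v * u)      ≈⟨ solve 4 (λ y u i v → (y :* i) :* (v :* u) := y :* (v :* (i :* u))) refl y u (v′ ⁻¹) v ⟩
    y * (v * (v′ ⁻¹ * u))      ≈⟨ *-congˡ (*-⁻¹-cancelˡ v′ u) ⟩
    y * u                      ∎

  -- `invertible` may choose its inverse depending on the representative and on the proof of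
  -- nonvanishing; uniqueness of inverses makes the choice harmless.
  ⁻¹-cong : (u v : Unit) → proj₁ u ≈ proj₁ v → u ⁻¹ ≈ v ⁻¹
  ⁻¹-cong u v u≈v = inverse-unique (⁻¹-inverseʳ u) (trans (*-congʳ u≈v) (⁻¹-inverseʳ v))

  unitGroup : AbelianGroup _ _
  unitGroup = record
    { Carrier        = Unit
    ; _≈_            = Setoid._≈_ unitSetoid
    ; _∙_            = λ (x , x≉0) (y , y≉0) → x * y , *-nonzero x≉0 y≉0
    ; ε              = 1# , 1≉0
    ; _⁻¹            = λ u → u ⁻¹ , ⁻¹-nonzero u
    ; isAbelianGroup = record
      { isGroup = record
        { isMonoid = record
          { isSemigroup = record
            { isMagma = record { isEquivalence = Setoid.isEquivalence unitSetoid ; ∙-cong = *-cong }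
            ; assoc   = λ _ _ _ → *-assoc _ _ _
            }
          ; identity = (λ _ → *-identityˡ _) , (λ _ → *-identityʳ _)
          }
        ; inverse = ⁻¹-inverseˡ , ⁻¹-inverseʳ
        ; ⁻¹-cong = λ {u} {v} → ⁻¹-cong u v
        }
      ; comm = λ _ _ → *-comm _ _
      }
    }

module FiniteField {c ℓ} (K : Field c ℓ) {n : ℕ} (I : HasCardinality (Field.setoid K) (2 ℕ.^ n)) where
  open Field K
  open FieldProperties K public
  open Finite I public
  open import Algebra.Properties.CommutativeSemiring.Exp commutativeSemiring
  open import Algebra.Properties.Semiring.Mult semiring using (×-homo-1; ×1-homo-*) renaming (_×_ to _·_)
  import Algebra.Properties.Monoid.Mult as Mult
  open import Algebra.Solver.Ring.NaturalCoefficients.Default commutativeSemiring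
  open import Relation.Binary.Reasoning.Setoid setoid

  -- The order of the additive group annihilates 1, so the 2^n-fold sum of 1 vanishes. That sum is a
  -- power of 1 + 1, whose factors are cancelled one at a time unless 1 + 1 is already zero.
  2≈0 : 1# + 1# ≈ 0#
  2≈0 = power-of-2 n (order-annihilates +-abelianGroup I 1#)
    where
    power-of-2 : ∀ m → (2 ℕ.^ m) · 1# ≈ 0# → 1# + 1# ≈ 0#
    power-of-2 ℕ.zero    1·1≈0 = ⊥-elim (1≉0 (trans (sym (×-homo-1 1#)) 1·1≈0))
    power-of-2 (ℕ.suc m) eq with (1# + 1#) ≈? 0#
    ... | yes 2≈0 = 2≈0
    ... | no  2≉0 = power-of-2 m (nonzero-factor 2≉0 (begin
      (1# + 1#) * (2 ℕ.^ m) · 1#  ≈⟨ *-congʳ (+-congˡ (+-identityʳ 1#)) ⟨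
      2 · 1# * (2 ℕ.^ m) · 1#     ≈⟨ ×1-homo-* 2 (2 ℕ.^ m) ⟨
      (2 ℕ.* 2 ℕ.^ m) · 1#        ≈⟨ eq ⟩
      0#                          ∎))

  -- The ring solver is blind to the characteristic: its identities are stated with an
  -- explicit multiple of 1 + 1, which this lemma discards.
  drop-double : ∀ {x y z} → x ≈ y + (1# + 1#) * z → x ≈ y
  drop-double {x} {y} {z} eq = begin
    x                    ≈⟨ eq ⟩
    y + (1# + 1#) * z    ≈⟨ +-congˡ (trans (*-congʳ 2≈0) (zeroˡ z)) ⟩
    y + 0#               ≈⟨ +-identityʳ y ⟩
    y                    ∎

  x+x≈0 : ∀ x → x + x ≈ 0#
  x+x≈0 x = drop-double (solve 1 (λ x → x :+ x := con 0 :+ (con 1 :+ con 1) :* x) refl x)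

  +≈0⇒≈ : ∀ {x y} → x + y ≈ 0# → x ≈ y
  +≈0⇒≈ {x} {y} x+y≈0 = begin
    x              ≈⟨ drop-double (solve 2 (λ x y → (x :+ y) :+ y := x :+ (con 1 :+ con 1) :* y) refl x y) ⟨
    (x + y) + y    ≈⟨ +-congʳ x+y≈0 ⟩
    0# + y         ≈⟨ +-identityˡ y ⟩
    y              ∎

  ≈⇒+≈0 : ∀ {x y} → x ≈ y → x + y ≈ 0#
  ≈⇒+≈0 {x} {y} x≈y = trans (+-congʳ x≈y) (x+x≈0 y)

  frobenius-+ : ∀ m x y → (x + y) ^ (2 ℕ.^ m) ≈ x ^ (2 ℕ.^ m) + y ^ (2 ℕ.^ m)
  frobenius-+ ℕ.zero    x y = trans (*-identityʳ _) (+-cong (sym (*-identityʳ x)) (sym (*-identityʳ y)))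
  frobenius-+ (ℕ.suc m) x y = begin
    (x + y) ^ (2 ℕ.* 2 ℕ.^ m)                    ≈⟨ ^-assocʳ (x + y) 2 (2 ℕ.^ m) ⟨
    ((x + y) ^ 2) ^ (2 ℕ.^ m)                    ≈⟨ ^-congˡ (2 ℕ.^ m) (drop-double (solve 2 (λ x y →
      (x :+ y) :^ 2 := (x :^ 2 :+ y :^ 2) :+ (con 1 :+ con 1) :* (x :* y)) refl x y)) ⟩
    (x ^ 2 + y ^ 2) ^ (2 ℕ.^ m)                  ≈⟨ frobenius-+ m (x ^ 2) (y ^ 2) ⟩
    (x ^ 2) ^ (2 ℕ.^ m) + (y ^ 2) ^ (2 ℕ.^ m)    ≈⟨ +-cong (^-assocʳ x 2 (2 ℕ.^ m)) (^-assocʳ y 2 (2 ℕ.^ m)) ⟩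
    x ^ (2 ℕ.* 2 ℕ.^ m) + y ^ (2 ℕ.* 2 ℕ.^ m)    ∎

  1^≈1 : ∀ m → 1# ^ m ≈ 1#
  1^≈1 ℕ.zero    = refl
  1^≈1 (ℕ.suc m) = trans (*-identityˡ _) (1^≈1 m)

  ^-nonzero : ∀ {x} m → Nonzero x → Nonzero (x ^ m)
  ^-nonzero ℕ.zero    x≉0 = 1≉0
  ^-nonzero (ℕ.suc m) x≉0 = *-nonzero x≉0 (^-nonzero m x≉0)

  -- The exponent must be exposed as a successor, because `0# ^ 0` is `1#`.
  0^2^≈0 : ∀ m → 0# ^ (2 ℕ.^ m) ≈ 0#
  0^2^≈0 m with 2 ℕ.^ m | ℕ.m^n>0 2 m
  ... | ℕ.suc _ | _ = zeroˡ _

  -- The field splits into the class of zero, which has one element, and its complement. The form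
  -- `suc m` avoids truncated subtraction and lets one factor x be split off x^q.
  units : ∃ λ m → ℕ.suc m ≡ 2 ℕ.^ n × HasCardinality unitSetoid m
  units with split (λ x≈y x≈0 → trans (sym x≈y) x≈0) (_≈? 0#)
  ... | k , m , k+m≡q , J , J′ =
    m , ≡.subst (λ k → k ℕ.+ m ≡ 2 ℕ.^ n)
          (cardinality-unique J (cardinality-one _ (0# , refl) (λ (_ , y≈0) → sym y≈0))) k+m≡q , J′

  units-cardinality : HasCardinality unitSetoid (2 ℕ.^ n ℕ.∸ 1)
  units-cardinality = ≡.subst (HasCardinality unitSetoid) (≡.cong ℕ.pred (proj₁ (proj₂ units))) (proj₂ (proj₂ units))

  ^-order : ∀ x → x ^ (2 ℕ.^ n) ≈ x
  ^-order x with x ≈? 0#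
  ... | yes x≈0 = trans (^-congˡ (2 ℕ.^ n) x≈0) (trans (0^2^≈0 n) (sym x≈0))
  ... | no  x≉0 = begin
    x ^ (2 ℕ.^ n)   ≡⟨ ≡.cong (x ^_) (proj₁ (proj₂ units)) ⟨
    x * x ^ q-1     ≈⟨ *-congˡ (unit-power q-1) ⟨
    x * proj₁ (q-1 ·ᵘ (x , x≉0))  ≈⟨ *-congˡ (order-annihilates unitGroup (proj₂ (proj₂ units)) (x , x≉0)) ⟩
    x * 1#          ≈⟨ *-identityʳ x ⟩
    x               ∎
    where
    q-1 = proj₁ units
    open Mult (AbelianGroup.monoid unitGroup) using () renaming (_×_ to _·ᵘ_)
    unit-power : ∀ m → proj₁ (m ·ᵘ (x , x≉0)) ≈ x ^ m
    unit-power ℕ.zero    = refl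
    unit-power (ℕ.suc m) = *-congˡ (unit-power m)

  fixed-multiple : ∀ {x} m j → x ^ (2 ℕ.^ m) ≈ x → x ^ (2 ℕ.^ (j ℕ.* m)) ≈ x
  fixed-multiple m ℕ.zero    fixed = *-identityʳ _
  fixed-multiple {x} m (ℕ.suc j) fixed = begin
    x ^ (2 ℕ.^ (m ℕ.+ j ℕ.* m))              ≡⟨ ≡.cong (x ^_) (ℕ.^-distribˡ-+-* 2 m (j ℕ.* m)) ⟩
    x ^ (2 ℕ.^ m ℕ.* 2 ℕ.^ (j ℕ.* m))        ≈⟨ ^-assocʳ x (2 ℕ.^ m) (2 ℕ.^ (j ℕ.* m)) ⟨
    (x ^ (2 ℕ.^ m)) ^ (2 ℕ.^ (j ℕ.* m))      ≈⟨ ^-congˡ (2 ℕ.^ (j ℕ.* m)) fixed ⟩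
    x ^ (2 ℕ.^ (j ℕ.* m))                    ≈⟨ fixed-multiple m j fixed ⟩
    x                                        ∎

  -- x^(2^(m+1)) is the square of x^(2^m). Consecutive exponents are what a Bézout identity over the
  -- natural numbers provides.
  fixed-consecutive : ∀ {x} m → x ^ (2 ℕ.^ m) ≈ x → x ^ (2 ℕ.^ ℕ.suc m) ≈ x → x ^ 2 ≈ x
  fixed-consecutive {x} m fixed fixed⁺ = begin
    x ^ 2                    ≈⟨ ^-congˡ 2 fixed ⟨
    (x ^ (2 ℕ.^ m)) ^ 2      ≈⟨ ^-assocʳ x (2 ℕ.^ m) 2 ⟩
    x ^ (2 ℕ.^ m ℕ.* 2)      ≡⟨ ≡.cong (x ^_) (ℕ.*-comm (2 ℕ.^ m) 2) ⟩
    x ^ (2 ℕ.^ ℕ.suc m)      ≈⟨ fixed⁺ ⟩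
    x                        ∎

  -- The automorphism σ, its fixed field, and the map ℘

  module Coprime {h : ℕ} (coprime : gcd n h ≡ 1) where

    fixed⇒1 : ∀ {x} → Nonzero x → x ^ (2 ℕ.^ h) ≈ x → x ≈ 1#
    fixed⇒1 {x} x≉0 fixed = trans (sym (*-identityʳ x)) (*-cancelˡ x≉0 (begin
      x * (x * 1#)   ≈⟨ idempotent ⟩
      x              ≈⟨ *-identityʳ x ⟨
      x * 1#         ∎))
      where
      by-bézout : Bézout.Identity 1 n h → x ^ 2 ≈ x
      -- Here 1 + j h = i n, and in the other case 1 + i n = j h. Multiples of n fix x because x^q =
      -- x, multiples of h by hypothesis; so squaring fixes x, and a nonzero idempotent is 1.
      by-bézout (Bézout.+- i j eq) = fixed-consecutive (j ℕ.* h) (fixed-multiple h j fixed)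
        (≡.subst (λ k → x ^ (2 ℕ.^ k) ≈ x) (≡.sym eq) (fixed-multiple n i (^-order x)))
      by-bézout (Bézout.-+ i j eq) = fixed-consecutive (i ℕ.* n) (fixed-multiple n i (^-order x))
        (≡.subst (λ k → x ^ (2 ℕ.^ k) ≈ x) (≡.sym eq) (fixed-multiple h j fixed))
      idempotent : x ^ 2 ≈ x
      idempotent = by-bézout (≡.subst (λ d → Bézout.Identity d n h) coprime (Bézout.identity (gcd-GCD n h)))

    σ : Carrier → Carrier
    σ x = x ^ (2 ℕ.^ h)

    σ-cong : ∀ {x y} → x ≈ y → σ x ≈ σ y
    σ-cong = ^-congˡ (2 ℕ.^ h)

    σ-* : ∀ x y → σ (x * y) ≈ σ x * σ y
    σ-* x y = ^-distrib-* x y (2 ℕ.^ h)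

    σ-+ : ∀ x y → σ (x + y) ≈ σ x + σ y
    σ-+ = frobenius-+ h

    σ-1 : σ 1# ≈ 1#
    σ-1 = 1^≈1 (2 ℕ.^ h)

    σ-0 : σ 0# ≈ 0#
    σ-0 = 0^2^≈0 h

    σ-nonzero : ∀ {x} → Nonzero x → Nonzero (σ x)
    σ-nonzero = ^-nonzero (2 ℕ.^ h)

    σ-injective : ∀ {x y} → σ x ≈ σ y → x ≈ y
    σ-injective {x} {y} eq with (x + y) ≈? 0#
    ... | yes x+y≈0 = +≈0⇒≈ x+y≈0
    ... | no  x+y≉0 = ⊥-elim (σ-nonzero x+y≉0 (trans (σ-+ x y) (≈⇒+≈0 eq)))

    σ-surjective : ∀ y → ∃ λ x → σ x ≈ y
    σ-surjective = injective⇒surjective-on σ σ-cong σ-injective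

    fixed⇒0⊎1 : ∀ {x} → σ x ≈ x → x ≈ 0# ⊎ x ≈ 1#
    fixed⇒0⊎1 {x} fixed with x ≈? 0#
    ... | yes x≈0 = inj₁ x≈0
    ... | no  x≉0 = inj₂ (fixed⇒1 x≉0 fixed)

    -- Cancelling σ v leaves σ k = k. This serves both the injectivity of v ↦ σ v / v and the
    -- uniqueness of the normal form of a generic point.
    σ-homogeneous⇒1 : ∀ {k v} → Nonzero k → Nonzero v → σ (k * v) ≈ k * σ v → k ≈ 1#
    σ-homogeneous⇒1 {k} {v} k≉0 v≉0 eq = fixed⇒1 k≉0 (*-cancelˡ (σ-nonzero v≉0) (begin
      σ v * σ k      ≈⟨ *-comm _ _ ⟩
      σ k * σ v      ≈⟨ σ-* k v ⟨
      σ (k * v)      ≈⟨ eq ⟩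
      k * σ v        ≈⟨ *-comm _ _ ⟩
      σ v * k        ∎))

    -- v ↦ σ v / v has trivial kernel on the units, so it is onto.
    σ-ratio : ∀ {x y} → Nonzero x → Nonzero y → ∃ λ v → Nonzero v × σ v * y ≈ x * v
    σ-ratio {x} {y} x≉0 y≉0 = proj₁ v , proj₂ v , cross-multiply v (y , y≉0) (proj₂ solution)
      where
      ratio : Unit → Unit
      ratio u = σ (proj₁ u) * u ⁻¹ , *-nonzero (σ-nonzero (proj₂ u)) (⁻¹-nonzero u)
      ratio-injective : ∀ {u v} → proj₁ (ratio u) ≈ proj₁ (ratio v) → proj₁ u ≈ proj₁ v
      ratio-injective {u , u≉0} {v , v≉0} eq = begin
        u              ≈⟨ u≈kv ⟩
        k * v          ≈⟨ *-congʳ (σ-homogeneous⇒1 k≉0 v≉0 σkv≈kσv) ⟩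
        1# * v         ≈⟨ *-identityˡ v ⟩
        v              ∎
        where
        k = (v , v≉0) ⁻¹ * u
        k≉0 = *-nonzero (⁻¹-nonzero (v , v≉0)) u≉0
        u≈kv : u ≈ k * v
        u≈kv = sym (trans (*-comm k v) (*-⁻¹-cancelˡ (v , v≉0) u))
        σkv≈kσv : σ (k * v) ≈ k * σ v
        σkv≈kσv = *-cancelˡ v≉0 (begin
          v * σ (k * v)    ≈⟨ *-comm _ _ ⟩
          σ (k * v) * v    ≈⟨ *-congʳ (σ-cong u≈kv) ⟨
          σ u * v          ≈⟨ cross-multiply (u , u≉0) (v , v≉0) eq ⟩
          σ v * u          ≈⟨ *-congˡ u≈kv ⟩
          σ v * (k * v)    ≈⟨ solve 3 (λ s k v → s :* (k :* v) := v :* (k :* s)) refl (σ v) k v ⟩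
          v * (k * σ v)    ∎)
      solution = Finite.injective⇒surjective-on units-cardinality ratio
        (λ {u} {v} u≈v → *-cong (σ-cong u≈v) (⁻¹-cong u v u≈v))
        (λ {u} {v} → ratio-injective {u} {v})
        (x * (y , y≉0) ⁻¹ , *-nonzero x≉0 (⁻¹-nonzero (y , y≉0)))
      v = proj₁ solution

    -- The Artin-Schreier map u ↦ σ u - u of σ, with the sign immaterial in characteristic 2.
    ℘ : Carrier → Carrier
    ℘ u = σ u + u

    ℘-cong : ∀ {x y} → x ≈ y → ℘ x ≈ ℘ y
    ℘-cong x≈y = +-cong (σ-cong x≈y) x≈y

    ℘-+ : ∀ x y → ℘ (x + y) ≈ ℘ x + ℘ y
    ℘-+ x y = trans (+-congʳ (σ-+ x y))
      (solve 4 (λ a b x y → (a :+ b) :+ (x :+ y) := (a :+ x) :+ (b :+ y)) refl (σ x) (σ y) x y)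

    ℘-1 : ℘ 1# ≈ 0#
    ℘-1 = trans (+-congʳ σ-1) 2≈0

    ℘-fibre : ∀ {x y} → ℘ x ≈ ℘ y → x ≈ y ⊎ x + 1# ≈ y
    ℘-fibre {x} {y} eq with fixed⇒0⊎1 (+≈0⇒≈ (trans (℘-+ x y) (≈⇒+≈0 eq)))
    ... | inj₁ x+y≈0 = inj₁ (+≈0⇒≈ x+y≈0)
    ... | inj₂ x+y≈1 = inj₂ (+≈0⇒≈ (trans
      (solve 2 (λ x y → x :+ con 1 :+ y := x :+ y :+ con 1) refl x y) (≈⇒+≈0 x+y≈1)))

    ℘-translate : ∀ x → ℘ (x + 1#) ≈ ℘ x
    ℘-translate x = trans (℘-+ x 1#) (trans (+-congˡ ℘-1) (+-identityʳ _))

    x≉x+1 : ∀ {x} → ¬ (x ≈ x + 1#)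
    x≉x+1 {x} x≈x+1 = 1≉0 (trans
      (sym (drop-double (solve 1 (λ x → x :+ (x :+ con 1) := con 1 :+ (con 1 :+ con 1) :* x) refl x)))
      (≈⇒+≈0 x≈x+1))

    Image : Pred Carrier _
    Image w = ∃ λ u → ℘ u ≈ w

    Image? : ∀ w → Dec (Image w)
    Image? w = ∃? (λ x≈y ℘x≈w → trans (sym (℘-cong x≈y)) ℘x≈w) (λ u → ℘ u ≈? w)

    -- Choose a root of each value of ℘. The chosen roots and their translates by 1 exhaust the
    -- field without repetition, so the image has q/2 elements and the complement has the rest.
    halves : ∃ λ m → m ℕ.* 2 ≡ 2 ℕ.^ n × HasCardinality (subset setoid Image) m
                                      × HasCardinality (subset setoid (∁ Image)) m
    halves with split (λ w≈z (u , ℘u≈w) → u , trans ℘u≈w w≈z) Image?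
    ... | k , l , k+l≡q , J , J′ = k , k*2≡q , J , ≡.subst (HasCardinality _) l≡k J′
      where
      module J = Inverse J
      root : Fin k → Carrier
      root i = proj₁ (proj₂ (J.from i))
      ℘-root : ∀ i → ℘ (root i) ≈ proj₁ (J.from i)
      ℘-root i = proj₂ (proj₂ (J.from i))
      f : Fin k × Fin 2 → Carrier
      f (i , 0F) = root i
      f (i , 1F) = root i + 1#
      ℘-f : ∀ x → ℘ (f x) ≈ proj₁ (J.from (proj₁ x))
      ℘-f (i , 0F) = ℘-root i
      ℘-f (i , 1F) = trans (℘-translate (root i)) (℘-root i)
      f-injective : ∀ {x y} → f x ≈ f y → x ≡ y
      -- Applying ℘ forgets the translation by 1, so the indices agree first; the bits then agree
      -- because x differs from x + 1.
      f-injective {x@(i , b)} {y@(j , c)} eq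
        with from-injective J {i} {j} (trans (sym (℘-f x)) (trans (℘-cong eq) (℘-f y)))
      f-injective {_ , 0F} {_ , 0F} eq | ≡.refl = ≡.refl
      f-injective {_ , 0F} {_ , 1F} eq | ≡.refl = ⊥-elim (x≉x+1 eq)
      f-injective {_ , 1F} {_ , 0F} eq | ≡.refl = ⊥-elim (x≉x+1 (sym eq))
      f-injective {_ , 1F} {_ , 1F} eq | ≡.refl = ≡.refl
      f-surjective : ∀ u → ∃ λ x → f x ≈ u
      f-surjective u
        with ℘-fibre {root (J.to (℘ u , u , refl))} {u} (trans (℘-root _) (J.strictlyInverseʳ (℘ u , u , refl)))
      ... | inj₁ eq = (_ , 0F) , eq
      ... | inj₂ eq = (_ , 1F) , eq
      k*2≡q : k ℕ.* 2 ≡ 2 ℕ.^ n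
      k*2≡q = cardinality-unique
        (Inv.trans (Inv.sym (bijective⇒Inverse (≡.setoid (Fin k × Fin 2)) setoid f
          (λ x≡y → reflexive (≡.cong f x≡y)) f-injective f-surjective)) (Inv.sym Fin.*↔×)) I
      l≡k : l ≡ k
      l≡k = ℕ.+-cancelˡ-≡ k l k (≡.trans k+l≡q (≡.trans (≡.sym k*2≡q)
        (≡.trans (ℕ.*-comm k 2) (≡.cong (k ℕ.+_) (ℕ.+-identityʳ k)))))

-- The symplectic polarity and its isometries

module Polarity {c ℓ} (K : Field c ℓ) where
  open Field K
  open PG3 K
  open FieldProperties K
  open import Algebra.Properties.Monoid.Sum +-monoid using (sum; sum-cong-≋)
  open import Algebra.Solver.Ring.NaturalCoefficients.Default commutativeSemiring
  open import Relation.Binary.Reasoning.Setoid setoid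

  module Pt = Setoid Points

  ≈⇒∼ : ∀ P Q → (∀ i → coord P i ≈ coord Q i) → P ∼ Q
  ≈⇒∼ P Q P≈Q = 1# , 1≉0 , λ i → trans (P≈Q i) (sym (*-identityˡ _))

  infix 4 _⟂_
  _⟂_ : Point → Point → Set ℓ
  P ⟂ Q = form (coord P) (coord Q) ≈ 0#

  form-cong : ∀ {x x′ y y′} → (∀ i → x i ≈ x′ i) → (∀ i → y i ≈ y′ i) → form x y ≈ form x′ y′
  form-cong p q = +-cong (+-cong (+-cong (*-cong (p 0F) (q 3F)) (*-cong (p 1F) (q 2F)))
    (*-cong (p 2F) (q 1F))) (*-cong (p 3F) (q 0F))

  form-sym : ∀ x y → form x y ≈ form y x
  form-sym x y = solve 8 (λ x₀ x₁ x₂ x₃ y₀ y₁ y₂ y₃ →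
    x₀ :* y₃ :+ x₁ :* y₂ :+ x₂ :* y₁ :+ x₃ :* y₀ := y₀ :* x₃ :+ y₁ :* x₂ :+ y₂ :* x₁ :+ y₃ :* x₀)
    refl (x 0F) (x 1F) (x 2F) (x 3F) (y 0F) (y 1F) (y 2F) (y 3F)

  form-scale : ∀ k x y → form (λ i → k * x i) y ≈ k * form x y
  form-scale k x y = solve 9 (λ k x₀ x₁ x₂ x₃ y₀ y₁ y₂ y₃ →
    k :* x₀ :* y₃ :+ k :* x₁ :* y₂ :+ k :* x₂ :* y₁ :+ k :* x₃ :* y₀ :=
    k :* (x₀ :* y₃ :+ x₁ :* y₂ :+ x₂ :* y₁ :+ x₃ :* y₀))
    refl k (x 0F) (x 1F) (x 2F) (x 3F) (y 0F) (y 1F) (y 2F) (y 3F)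

  ⟂-sym : ∀ P Q → P ⟂ Q → Q ⟂ P
  ⟂-sym P Q P⟂Q = trans (form-sym (coord Q) (coord P)) P⟂Q

  ⟂-respˡ : ∀ {P P′} Q → P ∼ P′ → P′ ⟂ Q → P ⟂ Q
  ⟂-respˡ {P} {P′} Q (k , _ , eq) P′⟂Q = begin
    form (coord P) (coord Q)                      ≈⟨ form-cong {y = coord Q} eq (λ _ → refl) ⟩
    form (λ i → k * coord P′ i) (coord Q)         ≈⟨ form-scale k (coord P′) (coord Q) ⟩
    k * form (coord P′) (coord Q)                 ≈⟨ *-congˡ P′⟂Q ⟩
    k * 0#                                        ≈⟨ zeroʳ k ⟩
    0#                                            ∎

  ⟂-respʳ : ∀ P {Q Q′} → Q ∼ Q′ → P ⟂ Q′ → P ⟂ Q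
  ⟂-respʳ P {Q} {Q′} Q∼Q′ P⟂Q′ = ⟂-sym Q P (⟂-respˡ {Q} {Q′} P Q∼Q′ (⟂-sym P Q′ P⟂Q′))

  -- The Gram matrix of the form is the antidiagonal permutation matrix. This is what makes 𝔰 an
  -- involution on coordinates.
  ^𝔰-coord : ∀ P i → coord (P ^𝔰) i ≈ coord P (opposite i)
  ^𝔰-coord P = λ where
      0F → solve 4 (λ a b c d → a :* con 0 :+ b :* con 0 :+ c :* con 0 :+ d :* con 1 := d) refl (x 0F) (x 1F) (x 2F) (x 3F)
      1F → solve 4 (λ a b c d → a :* con 0 :+ b :* con 0 :+ c :* con 1 :+ d :* con 0 := c) refl (x 0F) (x 1F) (x 2F) (x 3F)
      2F → solve 4 (λ a b c d → a :* con 0 :+ b :* con 1 :+ c :* con 0 :+ d :* con 0 := b) refl (x 0F) (x 1F) (x 2F) (x 3F)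
      3F → solve 4 (λ a b c d → a :* con 1 :+ b :* con 0 :+ c :* con 0 :+ d :* con 0 := a) refl (x 0F) (x 1F) (x 2F) (x 3F)
    where x = coord P

  ^𝔰-involutive : ∀ P i → coord (P ^𝔰 ^𝔰) i ≈ coord P i
  ^𝔰-involutive P i = trans (^𝔰-coord (P ^𝔰) i) (trans (^𝔰-coord P (opposite i))
    (reflexive (≡.cong (coord P) (Fin.opposite-involutive i))))

  ^𝔰-cong : ∀ P Q → P ∼ Q → (P ^𝔰) ∼ (Q ^𝔰)
  ^𝔰-cong P Q (k , k≉0 , eq) = k , k≉0 , λ i →
    trans (^𝔰-coord P i) (trans (eq (opposite i)) (*-congˡ (sym (^𝔰-coord Q i))))

  involution⇒Inverse : (f : Point → Point) → (∀ P Q → P ∼ Q → f P ∼ f Q) →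
    (∀ P → f (f P) ∼ P) → Inverse Points Points
  involution⇒Inverse f f-cong f-involutive = record
    { to        = f
    ; from      = f
    ; to-cong   = λ {P} {Q} → f-cong P Q
    ; from-cong = λ {P} {Q} → f-cong P Q
    ; inverse   = (λ {P} {Q} → cancel P Q) , (λ {P} {Q} → cancel P Q)
    }
    where
    cancel : ∀ P Q → Q ∼ f P → f Q ∼ P
    cancel P Q Q∼fP = Pt.trans {f Q} {f (f P)} {P} (f-cong Q (f P) Q∼fP) (f-involutive P)

  polarity : Inverse Points Planes
  polarity = involution⇒Inverse _^𝔰 ^𝔰-cong (λ P → ≈⇒∼ (P ^𝔰 ^𝔰) P (^𝔰-involutive P))

  Respects∼ : ∀ {p} → Pred Point p → Set _
  Respects∼ S = ∀ P Q → P ∼ Q → S P → S Q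

  Conjugates : ∀ {p} → Pred Point p → Point → Setoid _ _
  Conjugates S P = subset Points (λ Q → Q ∈ S × Q ⟂ P)

  -- A plane of `S ˢ` is only proportional to some Q^𝔰, so its pole is only proportional to Q;
  -- therefore `S` has to respect `∼`. It is applied to 𝒜, giving the osculating planes through P,
  -- and to every class `𝒪 d`.
  conjugates↔planes : ∀ {p} {S : Pred Point p} → Respects∼ S → ∀ P →
    Inverse (Conjugates S P) (subset Planes (λ π → π ∈ (S ˢ) × P LiesOn π))
  conjugates↔planes {S = S} resp P = subset-inverse Points Planes polarity
    (λ {Q} (Q∈S , Q⟂P) → (Q , Q∈S , Pt.refl {Q ^𝔰}) , trans (^𝔰-form Q P) Q⟂P)
    (λ {π} ((Q , Q∈S , π∼Qˢ) , P∈π) →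
      resp Q (π ^𝔰) (Pt.sym {π ^𝔰} {Q} (Inverse.inverseʳ polarity {Q} {π} π∼Qˢ)) Q∈S ,
      (begin
        form (coord (π ^𝔰)) (coord P)                     ≈⟨ ^𝔰-form (π ^𝔰) P ⟨
        sum (λ i → coord (π ^𝔰 ^𝔰) i * coord P i)         ≈⟨ sum-cong-≋ (λ i → *-congʳ {coord P i} (^𝔰-involutive π i)) ⟩
        sum (λ i → coord π i * coord P i)                 ≈⟨ P∈π ⟩
        0#                                                ∎))

  conjugates-cong : ∀ {p} (S : Pred Point p) P Q → P ∼ Q → Inverse (Conjugates S P) (Conjugates S Q)
  conjugates-cong S P Q P∼Q = subset-cong Points
    (λ {R} (R∈S , R⟂P) → R∈S , ⟂-respʳ R {Q} {P} (Pt.sym {P} {Q} P∼Q) R⟂P)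
    (λ {R} (R∈S , R⟂Q) → R∈S , ⟂-respʳ R {P} {Q} P∼Q R⟂Q)

  -- Involutivity is built in: such a map is its own inverse, so carrying a set into itself is
  -- enough to restrict it to a bijection of that set.
  record Isometry : Set (c ⊔ ℓ) where
    field
      apply      : Vector Carrier 4 → Vector Carrier 4
      apply-cong : ∀ {x y} → (∀ i → x i ≈ y i) → ∀ i → apply x i ≈ apply y i
      apply-*    : ∀ k x i → apply (λ j → k * x j) i ≈ k * apply x i
      involutive : ∀ x i → apply (apply x) i ≈ x i
      isometric  : ∀ x y → form (apply x) (apply y) ≈ form x y

    act : Point → Point
    act P = ⟨ apply x , (λ gx≈0 → nonzero P λ i → begin
      x i                              ≈⟨ involutive x i ⟨
      -- Only homogeneity of `apply` is available, so the zero vector is presented as a zero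
      -- multiple.
      apply (apply x) i                ≈⟨ apply-cong (λ j → trans (gx≈0 j) (sym (zeroˡ _))) i ⟩
      apply (λ j → 0# * apply x j) i   ≈⟨ apply-* 0# (apply x) i ⟩
      0# * apply (apply x) i           ≈⟨ zeroˡ _ ⟩
      0#                               ∎) ⟩
      where x = coord P

    act-cong : ∀ P Q → P ∼ Q → act P ∼ act Q
    act-cong P Q (k , k≉0 , eq) = k , k≉0 , λ i → trans (apply-cong eq i) (apply-* k (coord Q) i)

    act-involutive : ∀ P → act (act P) ∼ P
    act-involutive P = ≈⇒∼ (act (act P)) P (involutive (coord P))

    act-inverse : Inverse Points Points
    act-inverse = involution⇒Inverse act act-cong act-involutive

    Invariant : ∀ {p} → Pred Point p → Set _
    Invariant S = ∀ P → S P → S (act P)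

    conjugates-act : ∀ {p} {S : Pred Point p} → Invariant S → ∀ P →
      Inverse (Conjugates S P) (Conjugates S (act P))
    conjugates-act inv P = subset-inverse Points Points act-inverse
      (λ {Q} (Q∈S , Q⟂P) → inv Q Q∈S , trans (isometric (coord Q) (coord P)) Q⟂P)
      (λ {Q} (Q∈S , Q⟂gP) → inv Q Q∈S , (begin
        form (apply (coord Q)) (coord P)                        ≈⟨ form-cong {apply (coord Q)} (λ _ → refl) (involutive (coord P)) ⟨
        form (apply (coord Q)) (apply (apply (coord P)))        ≈⟨ isometric (coord Q) (apply (coord P)) ⟩
        form (coord Q) (apply (coord P))                        ≈⟨ Q⟂gP ⟩
        0#                                                      ∎))

  module Classes (h : ℕ) where
    open Arc h

    𝒜-resp : Respects∼ 𝒜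
    𝒜-resp P Q P∼Q (inj₁ (t , P∼Pt)) = inj₁ (t , Pt.trans {Q} {P} {P[ t ]} (Pt.sym {P} {Q} P∼Q) P∼Pt)
    𝒜-resp P Q P∼Q (inj₂ P∼U)        = inj₂ (Pt.trans {Q} {P} {U 3F} (Pt.sym {P} {Q} P∼Q) P∼U)

    osculating : ∀ P → Inverse (Conjugates 𝒜 P) (subset Planes (λ π → π ∈ Osculating × P LiesOn π))
    osculating = conjugates↔planes 𝒜-resp

    -- Counting osculating planes through P is counting points of 𝒜 conjugate to P, and conjugacy
    -- sees P only up to a scalar.
    𝒪-resp : ∀ d → Respects∼ (𝒪 d)
    𝒪-resp (# i) P Q P∼Q (P∉𝒜 , J) =
      (λ Q∈𝒜 → P∉𝒜 (𝒜-resp Q P (Pt.sym {P} {Q} P∼Q) Q∈𝒜)) ,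
      Inv.trans (Inv.sym (osculating Q)) (Inv.trans (Inv.sym (conjugates-cong 𝒜 P Q P∼Q)) (Inv.trans (osculating P) J))
    𝒪-resp q+1 = 𝒜-resp

    -- Membership in two numbered classes gives the same setoid of osculating planes two
    -- cardinalities, which must coincide.
    𝒪-disjoint : ∀ d d′ P → P ∈ 𝒪 d → P ∈ 𝒪 d′ → d ≡ d′
    𝒪-disjoint (# i) (# j) P (_ , I)   (_ , J)   = ≡.cong # (Fin.toℕ-injective (cardinality-unique I J))
    𝒪-disjoint (# i) q+1   P (P∉𝒜 , _) P∈𝒜       = ⊥-elim (P∉𝒜 P∈𝒜)
    𝒪-disjoint q+1   (# j) P P∈𝒜       (P∉𝒜 , _) = ⊥-elim (P∉𝒜 P∈𝒜)
    𝒪-disjoint q+1   q+1   P _         _         = ≡.refl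

    module _ (g : Isometry) where
      open Isometry g

      -- Each class is expressed through 𝒜 and conjugacy alone, and `g` preserves both.
      𝒪-invariant : Invariant 𝒜 → ∀ d → Invariant (𝒪 d)
      𝒪-invariant inv q+1           = inv
      𝒪-invariant inv (# i) P (P∉𝒜 , J) =
        (λ gP∈𝒜 → P∉𝒜 (𝒜-resp (act (act P)) P (act-involutive P) (inv (act P) gP∈𝒜))) ,
        Inv.trans (Inv.sym (osculating (act P)))
          (Inv.trans (Inv.sym (conjugates-act inv P)) (Inv.trans (osculating P) J))

      𝒜-invariant : (∀ t → 𝒜 (act P[ t ])) → 𝒜 (act (U 3F)) → Invariant 𝒜
      𝒜-invariant arc vertex P (inj₁ (t , P∼Pt)) =
        𝒜-resp (act P[ t ]) (act P) (act-cong P[ t ] P (Pt.sym {P} {P[ t ]} P∼Pt)) (arc t)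
      𝒜-invariant arc vertex P (inj₂ P∼U) =
        𝒜-resp (act (U 3F)) (act P) (act-cong (U 3F) P (Pt.sym {P} {U 3F} P∼U)) vertex

-- Points of the osculating plane at U₄

module Counting {c ℓ} (K : Field c ℓ) {n h : ℕ} (I : HasCardinality (Field.setoid K) (2 ℕ.^ n))
  (coprime : gcd n h ≡ 1) where
  open Field K
  open PG3 K
  open Arc h
  open FiniteField K {n} I
  open Coprime {h} coprime
  open Polarity K
  open Classes h
  open import Algebra.Properties.CommutativeSemiring.Exp commutativeSemiring using (_^_; ^-homo-*; ^-congˡ; ^-distrib-*)
  open import Algebra.Solver.Ring.NaturalCoefficients.Default commutativeSemiring
  open import Relation.Binary.Reasoning.Setoid setoid

  infixr 5 _∷≈_
  _∷≈_ : ∀ {m} {x y : Vector Carrier (ℕ.suc m)} → x 0F ≈ y 0F → (∀ i → x (suc i) ≈ y (suc i)) → ∀ i → x i ≈ y i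
  (x₀≈y₀ ∷≈ xs≈ys) zero    = x₀≈y₀
  (x₀≈y₀ ∷≈ xs≈ys) (suc i) = xs≈ys i

  []≈ : ∀ {x y : Vector Carrier 0} → ∀ i → x i ≈ y i
  []≈ ()

  -- Isometries that preserve 𝒜

  ^σ+1 : ∀ t → t ^ (2 ℕ.^ h ℕ.+ 1) ≈ σ t * t
  ^σ+1 t = trans (^-homo-* t (2 ℕ.^ h) 1) (*-congˡ (*-identityʳ t))

  -- The linear map inducing t ↦ t + s on 𝒜: expand the coordinates of P_{t+s} and replace 1, t, σ
  -- t, σ t t by the four coordinates of x. It is an involution since s + s = 0.
  translation : Carrier → Isometry
  translation s = record
    { apply      = τ
    ; apply-cong = λ eq → eq 0F ∷≈ +-cong (eq 1F) (*-congˡ (eq 0F)) ∷≈ +-cong (eq 2F) (*-congˡ (eq 0F))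
        ∷≈ +-cong (+-cong (+-cong (eq 3F) (*-congˡ (eq 2F))) (*-congˡ (eq 1F))) (*-congˡ (eq 0F)) ∷≈ []≈
    ; apply-*    = λ k x → refl
        ∷≈ solve 4 (λ k s a b → k :* b :+ s :* (k :* a) := k :* (b :+ s :* a)) refl k s (x 0F) (x 1F)
        ∷≈ solve 4 (λ k s a b → k :* b :+ s :* (k :* a) := k :* (b :+ s :* a)) refl k (σ s) (x 0F) (x 2F)
        ∷≈ solve 7 (λ k s s′ x₀ x₁ x₂ x₃ →
             k :* x₃ :+ s :* (k :* x₂) :+ s′ :* (k :* x₁) :+ s′ :* s :* (k :* x₀) :=
             k :* (x₃ :+ s :* x₂ :+ s′ :* x₁ :+ s′ :* s :* x₀)) refl k s (σ s) (x 0F) (x 1F) (x 2F) (x 3F)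
        ∷≈ []≈
    ; involutive = λ x → refl
        ∷≈ drop-double (solve 3 (λ s a b → b :+ s :* a :+ s :* a := b :+ (con 1 :+ con 1) :* (s :* a)) refl s (x 0F) (x 1F))
        ∷≈ drop-double (solve 3 (λ s a b → b :+ s :* a :+ s :* a := b :+ (con 1 :+ con 1) :* (s :* a)) refl (σ s) (x 0F) (x 2F))
        -- The term σ s s x₀ arises four times, hence the doubling inside the doubling.
        ∷≈ drop-double (solve 6 (λ s s′ x₀ x₁ x₂ x₃ →
             (x₃ :+ s :* x₂ :+ s′ :* x₁ :+ s′ :* s :* x₀) :+ s :* (x₂ :+ s′ :* x₀) :+ s′ :* (x₁ :+ s :* x₀) :+ s′ :* s :* x₀ :=
             x₃ :+ (con 1 :+ con 1) :* (s :* x₂ :+ s′ :* x₁ :+ (con 1 :+ con 1) :* (s′ :* s :* x₀)))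
             refl s (σ s) (x 0F) (x 1F) (x 2F) (x 3F))
        ∷≈ []≈
    ; isometric  = λ x y → drop-double (solve 10 (λ s s′ x₀ x₁ x₂ x₃ y₀ y₁ y₂ y₃ →
        x₀ :* (y₃ :+ s :* y₂ :+ s′ :* y₁ :+ s′ :* s :* y₀) :+ (x₁ :+ s :* x₀) :* (y₂ :+ s′ :* y₀)
          :+ (x₂ :+ s′ :* x₀) :* (y₁ :+ s :* y₀) :+ (x₃ :+ s :* x₂ :+ s′ :* x₁ :+ s′ :* s :* x₀) :* y₀ :=
        (x₀ :* y₃ :+ x₁ :* y₂ :+ x₂ :* y₁ :+ x₃ :* y₀) :+ (con 1 :+ con 1) :*
          (s :* (x₀ :* y₂ :+ x₂ :* y₀) :+ s′ :* (x₀ :* y₁ :+ x₁ :* y₀) :+ (con 1 :+ con 1) :* (s′ :* s :* x₀ :* y₀)))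
        refl s (σ s) (x 0F) (x 1F) (x 2F) (x 3F) (y 0F) (y 1F) (y 2F) (y 3F))
    }
    where
    τ : Vector Carrier 4 → Vector Carrier 4
    τ x = x 0F ∷ x 1F + s * x 0F ∷ x 2F + σ s * x 0F ∷ x 3F + s * x 2F + σ s * x 1F + σ s * s * x 0F ∷ []

  -- On 𝒜 this is t ↦ 1/t, with P₀ and U₄ exchanged.
  reversal : Isometry
  reversal = record
    { apply      = λ x → x ∘ opposite
    ; apply-cong = λ eq → eq ∘ opposite
    ; apply-*    = λ _ _ _ → refl
    ; involutive = λ x i → reflexive (≡.cong x (Fin.opposite-involutive i))
    ; isometric  = λ x y → solve 8 (λ x₀ x₁ x₂ x₃ y₀ y₁ y₂ y₃ →
        x₃ :* y₀ :+ x₂ :* y₁ :+ x₁ :* y₂ :+ x₀ :* y₃ := x₀ :* y₃ :+ x₁ :* y₂ :+ x₂ :* y₁ :+ x₃ :* y₀)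
        refl (x 0F) (x 1F) (x 2F) (x 3F) (y 0F) (y 1F) (y 2F) (y 3F)
    }

  open Isometry using (act)

  translation-arc : ∀ s t → act (translation s) P[ t ] ∼ P[ t + s ]
  translation-arc s t = ≈⇒∼ (act (translation s) P[ t ]) P[ t + s ]
    (refl
    ∷≈ +-congˡ (*-identityʳ s)
    ∷≈ trans (+-congˡ (*-identityʳ (σ s))) (sym (σ-+ t s))
    ∷≈ (begin
      t ^ (2 ℕ.^ h ℕ.+ 1) + s * σ t + σ s * t + σ s * s * 1#
        ≈⟨ +-congʳ (+-congʳ (+-congʳ (^σ+1 t))) ⟩
      σ t * t + s * σ t + σ s * t + σ s * s * 1#
        ≈⟨ solve 4 (λ s s′ t t′ → t′ :* t :+ s :* t′ :+ s′ :* t :+ s′ :* s :* con 1 := (t′ :+ s′) :* (t :+ s))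
             refl s (σ s) t (σ t) ⟩
      (σ t + σ s) * (t + s)          ≈⟨ *-congʳ (σ-+ t s) ⟨
      σ (t + s) * (t + s)            ≈⟨ ^σ+1 (t + s) ⟨
      (t + s) ^ (2 ℕ.^ h ℕ.+ 1)      ∎)
    ∷≈ []≈)

  translation-vertex : ∀ s → act (translation s) (U 3F) ∼ U 3F
  translation-vertex s = ≈⇒∼ (act (translation s) (U 3F)) (U 3F)
    (refl
    ∷≈ trans (+-congˡ (zeroʳ s)) (+-identityʳ _)
    ∷≈ trans (+-congˡ (zeroʳ (σ s))) (+-identityʳ _)
    ∷≈ solve 2 (λ s s′ → con 1 :+ s :* con 0 :+ s′ :* con 0 :+ s′ :* s :* con 0 := con 1) refl s (σ s)
    ∷≈ []≈)

  translation-𝒜 : ∀ s P → 𝒜 P → 𝒜 (act (translation s) P)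
  translation-𝒜 s = 𝒜-invariant (translation s)
    (λ t → inj₁ (t + s , translation-arc s t)) (inj₂ (translation-vertex s))

  reversal-vertex : act reversal (U 3F) ∼ P[ 0# ]
  reversal-vertex = ≈⇒∼ (act reversal (U 3F)) P[ 0# ]
    (refl ∷≈ refl ∷≈ sym σ-0 ∷≈ sym (trans (^σ+1 0#) (zeroʳ _)) ∷≈ []≈)

  reversal-arc : ∀ t → 𝒜 (act reversal P[ t ])
  reversal-arc t with t ≈? 0#
  ... | yes t≈0 = inj₂ (≈⇒∼ (act reversal P[ t ]) (U 3F)
    (trans (^σ+1 t) (trans (*-congˡ t≈0) (zeroʳ _)) ∷≈ trans (σ-cong t≈0) σ-0 ∷≈ t≈0 ∷≈ refl ∷≈ []≈))
  -- The reversed vector (σ t t, σ t, t, 1) has leading coordinate k = σ t t, so k is the scalar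
  -- that normalises it to P_{1/t}.
  ... | no  t≉0 = inj₁ (t⁻¹ , k , ^-nonzero (2 ℕ.^ h ℕ.+ 1) t≉0 ,
    (sym (*-identityʳ k)
    ∷≈ sym (begin
         k * t⁻¹             ≈⟨ *-congʳ (^σ+1 t) ⟩
         σ t * t * t⁻¹       ≈⟨ *-assoc _ _ _ ⟩
         σ t * (t * t⁻¹)     ≈⟨ *-congˡ tt⁻¹≈1 ⟩
         σ t * 1#            ≈⟨ *-identityʳ _ ⟩
         σ t                 ∎)
    ∷≈ sym (begin
         k * σ t⁻¹           ≈⟨ *-congʳ (^σ+1 t) ⟩
         σ t * t * σ t⁻¹     ≈⟨ solve 3 (λ a b c → a :* b :* c := b :* (a :* c)) refl (σ t) t (σ t⁻¹) ⟩
         t * (σ t * σ t⁻¹)   ≈⟨ *-congˡ (σ-* t t⁻¹) ⟨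
         t * σ (t * t⁻¹)     ≈⟨ *-congˡ (trans (σ-cong tt⁻¹≈1) σ-1) ⟩
         t * 1#              ≈⟨ *-identityʳ t ⟩
         t                   ∎)
    ∷≈ sym (begin
         k * t⁻¹ ^ (2 ℕ.^ h ℕ.+ 1)          ≈⟨ ^-distrib-* t t⁻¹ (2 ℕ.^ h ℕ.+ 1) ⟨
         (t * t⁻¹) ^ (2 ℕ.^ h ℕ.+ 1)        ≈⟨ ^-congˡ (2 ℕ.^ h ℕ.+ 1) tt⁻¹≈1 ⟩
         1# ^ (2 ℕ.^ h ℕ.+ 1)               ≈⟨ 1^≈1 (2 ℕ.^ h ℕ.+ 1) ⟩
         1#                                 ∎)
    ∷≈ []≈))
    where
    t⁻¹ = (t , t≉0) ⁻¹
    tt⁻¹≈1 : t * t⁻¹ ≈ 1#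
    tt⁻¹≈1 = ⁻¹-inverseʳ (t , t≉0)
    k = t ^ (2 ℕ.^ h ℕ.+ 1)

  reversal-𝒜 : ∀ P → 𝒜 P → 𝒜 (act reversal P)
  reversal-𝒜 = 𝒜-invariant reversal reversal-arc (inj₁ (0# , reversal-vertex))

  -- Reversal maps U₄ to P₀, and the translations act transitively on the remaining points of 𝒜.
  homogeneous : ∀ d P → P ∈ 𝒜 → Inverse (Conjugates (𝒪 d) P) (Conjugates (𝒪 d) (U 3F))
  homogeneous d P (inj₂ P∼U)        = conjugates-cong (𝒪 d) P (U 3F) P∼U
  homogeneous d P (inj₁ (t , P∼Pt)) =
    Inv.trans (conjugates-cong (𝒪 d) P τP₀ (Pt.trans {P} {P[ t ]} {τP₀} P∼Pt (Pt.sym {τP₀} {P[ t ]} τP₀∼Pt)))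
    (Inv.trans (Inv.sym (conjugates-act (translation t) (𝒪-invariant (translation t) (translation-𝒜 t) d) P[ 0# ]))
    (Inv.trans (Inv.sym (conjugates-cong (𝒪 d) (act reversal (U 3F)) P[ 0# ] reversal-vertex))
    (Inv.sym (conjugates-act reversal (𝒪-invariant reversal reversal-𝒜 d) (U 3F)))))
    where
    open Isometry using (conjugates-act)
    τP₀ = act (translation t) P[ 0# ]
    τP₀∼Pt : τP₀ ∼ P[ t ]
    τP₀∼Pt = Pt.trans {τP₀} {P[ 0# + t ]} {P[ t ]} (translation-arc t 0#)
      (≈⇒∼ P[ 0# + t ] P[ t ] (refl ∷≈ +-identityˡ t ∷≈ σ-cong (+-identityˡ t)
        ∷≈ ^-congˡ (2 ℕ.^ h ℕ.+ 1) (+-identityˡ t) ∷≈ []≈))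

  -- Osculating planes through a point of X₁ = 0

  ≁U₄ : ∀ {t} → ¬ (U 3F ∼ P[ t ])
  ≁U₄ (k , k≉0 , eq) = k≉0 (trans (sym (*-identityʳ k)) (sym (eq 0F)))

  ⟂U₄ : ∀ Q → coord Q 0F ≈ 0# → Q ⟂ U 3F
  ⟂U₄ Q x₀≈0 = trans (solve 4 (λ a b c d → a :* con 1 :+ b :* con 0 :+ c :* con 0 :+ d :* con 0 := a)
    refl (coord Q 0F) (coord Q 1F) (coord Q 2F) (coord Q 3F)) x₀≈0

  ⟂U₄⇒0 : ∀ Q → Q ⟂ U 3F → coord Q 0F ≈ 0#
  ⟂U₄⇒0 Q Q⟂U = trans (sym (solve 4 (λ a b c d → a :* con 1 :+ b :* con 0 :+ c :* con 0 :+ d :* con 0 := a)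
    refl (coord Q 0F) (coord Q 1F) (coord Q 2F) (coord Q 3F))) Q⟂U

  Roots : Point → Setoid _ _
  Roots Q = subset setoid (λ t → P[ t ] ⟂ Q)

  -- The summand `Fin 1` stands for U₄, whose osculating plane contains Q by hypothesis. Hence a
  -- point with k roots lies on k + 1 osculating planes, the shift that reappears in `classify`.
  conjugates-roots : ∀ Q → Q ⟂ U 3F → Inverse (⊎-setoid (≡.setoid (Fin 1)) (Roots Q)) (Conjugates 𝒜 Q)
  conjugates-roots Q Q⟂U = bijective⇒Inverse _ _ f
    (λ {x} {y} → f-cong {x} {y}) (λ {x} {y} → f-injective {x} {y}) f-surjective
    where
    f : Fin 1 ⊎ Setoid.Carrier (Roots Q) → Setoid.Carrier (Conjugates 𝒜 Q)
    f (inj₁ _)       = U 3F , inj₂ (Pt.refl {U 3F}) , ⟂-sym Q (U 3F) Q⟂U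
    f (inj₂ (t , r)) = P[ t ] , inj₁ (t , Pt.refl {P[ t ]}) , r
    f-cong : ∀ {x y} → Setoid._≈_ (⊎-setoid (≡.setoid (Fin 1)) (Roots Q)) x y → proj₁ (f x) ∼ proj₁ (f y)
    f-cong (⊎.inj₁ _) = Pt.refl {U 3F}
    f-cong (⊎.inj₂ {s , _} {t , _} s≈t) = ≈⇒∼ P[ s ] P[ t ]
      (refl ∷≈ s≈t ∷≈ σ-cong s≈t ∷≈ ^-congˡ (2 ℕ.^ h ℕ.+ 1) s≈t ∷≈ []≈)
    f-injective : ∀ {x y} → proj₁ (f x) ∼ proj₁ (f y) → Setoid._≈_ (⊎-setoid (≡.setoid (Fin 1)) (Roots Q)) x y
    f-injective {inj₁ 0F}      {inj₁ 0F}      _    = ⊎.inj₁ ≡.refl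
    f-injective {inj₁ 0F}      {inj₂ (t , _)} U∼Pt = ⊥-elim (≁U₄ U∼Pt)
    f-injective {inj₂ (s , _)} {inj₁ 0F}      Ps∼U = ⊥-elim (≁U₄ (Pt.sym {P[ s ]} {U 3F} Ps∼U))
    f-injective {inj₂ (s , _)} {inj₂ (t , _)} (k , _ , eq) = ⊎.inj₂ (begin
      s         ≈⟨ eq 1F ⟩
      k * t     ≈⟨ *-congʳ (trans (sym (*-identityʳ k)) (sym (eq 0F))) ⟩
      1# * t    ≈⟨ *-identityˡ t ⟩
      t         ∎)
    f-surjective : ∀ R → ∃ λ x → proj₁ (f x) ∼ proj₁ R
    f-surjective (R , inj₁ (t , R∼Pt) , R⟂Q) =
      inj₂ (t , ⟂-respˡ {P[ t ]} {R} Q (Pt.sym {R} {P[ t ]} R∼Pt) R⟂Q) , Pt.sym {R} {P[ t ]} R∼Pt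
    f-surjective (R , inj₂ R∼U , _) = inj₁ 0F , Pt.sym {R} {U 3F} R∼U

  classify : ∀ i Q → Q ∉ 𝒜 → Q ⟂ U 3F → ∀ {k} → ℕ.suc k ≡ toℕ i → HasCardinality (Roots Q) k → Q ∈ 𝒪 (# i)
  classify i Q Q∉𝒜 Q⟂U eq J = Q∉𝒜 , ≡.subst (HasCardinality _) eq
    (Inv.trans (Inv.sym (osculating Q)) (Inv.trans (Inv.sym (conjugates-roots Q Q⟂U))
      (cardinality-⊎ (Inv.refl (≡.setoid (Fin 1))) J)))

  planePoint : ∀ a b → ¬ (a ≈ 0# × b ≈ 0#) → Carrier → Point
  planePoint a b ab≉0 y = ⟨ 0# ∷ a ∷ b ∷ y ∷ [] , (λ eq → ab≉0 (eq 1F , eq 2F)) ⟩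

  module _ {a b} (ab≉0 : ¬ (a ≈ 0# × b ≈ 0#)) (y : Carrier) where
    private Q = planePoint a b ab≉0 y

    planePoint⟂U₄ : Q ⟂ U 3F
    planePoint⟂U₄ = ⟂U₄ Q refl

    planePoint∉𝒜 : Q ∉ 𝒜
    planePoint∉𝒜 (inj₁ (t , k , k≉0 , eq)) = k≉0 (trans (sym (*-identityʳ k)) (sym (eq 0F)))
    planePoint∉𝒜 (inj₂ (k , _ , eq))       = ab≉0 (trans (eq 1F) (zeroʳ k) , trans (eq 2F) (zeroʳ k))

    form-arc : ∀ t → form (coord P[ t ]) (coord Q) ≈ σ t * a + t * b + y
    form-arc t = solve 6 (λ z a b y t t′ → con 1 :* y :+ t :* b :+ t′ :* a :+ z :* con 0 := t′ :* a :+ t :* b :+ y)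
      refl (t ^ (2 ℕ.^ h ℕ.+ 1)) a b y t (σ t)

    root : ∀ {t} → σ t * a + t * b ≈ y → P[ t ] ⟂ Q
    root {t} eq = trans (form-arc t) (≈⇒+≈0 eq)

    root⁻¹ : ∀ {t} → P[ t ] ⟂ Q → σ t * a + t * b ≈ y
    root⁻¹ {t} Pt⟂Q = +≈0⇒≈ (trans (sym (form-arc t)) Pt⟂Q)

  01≉0 : ¬ (0# ≈ 0# × 1# ≈ 0#)
  01≉0 (_ , 1≈0) = 1≉0 1≈0

  10≉0 : ¬ (1# ≈ 0# × 0# ≈ 0#)
  10≉0 (1≈0 , _) = 1≉0 1≈0

  line₀₁ line₁₀ : Carrier → Point
  line₀₁ = planePoint 0# 1# 01≉0
  line₁₀ = planePoint 1# 0# 10≉0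

  σv,v≉0 : (v : Unit) → ¬ (σ (proj₁ v) ≈ 0# × proj₁ v ≈ 0#)
  σv,v≉0 (_ , v≉0) (_ , v≈0) = v≉0 v≈0

  generic : (v : Unit) → Carrier → Point
  generic v = planePoint (σ (proj₁ v)) (proj₁ v) (σv,v≉0 v)

  line₀₁∈𝒪₂ : ∀ y → line₀₁ y ∈ 𝒪 (# 2F)
  line₀₁∈𝒪₂ y = classify 2F (line₀₁ y) (planePoint∉𝒜 01≉0 y) (planePoint⟂U₄ 01≉0 y) ≡.refl
    (cardinality-one _ (y , root 01≉0 y (simplify y)) (λ (t , r) → trans (sym (root⁻¹ 01≉0 y r)) (simplify t)))
    where
    simplify : ∀ t → σ t * 0# + t * 1# ≈ t
    simplify t = solve 2 (λ t t′ → t′ :* con 0 :+ t :* con 1 := t) refl t (σ t)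

  -- The root equation reduces to σ t = y, which has one solution because σ is bijective.
  line₁₀∈𝒪₂ : ∀ y → line₁₀ y ∈ 𝒪 (# 2F)
  line₁₀∈𝒪₂ y = classify 2F (line₁₀ y) (planePoint∉𝒜 10≉0 y) (planePoint⟂U₄ 10≉0 y) ≡.refl
    (cardinality-one _ (z , root 10≉0 y (trans (simplify z) σz≈y))
      (λ (t , r) → σ-injective (trans σz≈y (trans (sym (root⁻¹ 10≉0 y r)) (simplify t)))))
    where
    simplify : ∀ t → σ t * 1# + t * 0# ≈ σ t
    simplify t = solve 2 (λ t t′ → t′ :* con 1 :+ t :* con 0 := t′) refl t (σ t)
    z = proj₁ (σ-surjective y)
    σz≈y = proj₂ (σ-surjective y)

  module _ (v′ : Unit) (w : Carrier) where
    private
      v = proj₁ v′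
      nz = σv,v≉0 v′
      ℘-root : ∀ t → σ t * σ v + t * v ≈ ℘ (t * v)
      ℘-root t = +-congʳ (sym (σ-* t v))
      unscale : ∀ u → (u * v′ ⁻¹) * v ≈ u
      unscale u = trans (*-assoc _ _ _) (trans (*-congˡ (⁻¹-inverseˡ v′)) (*-identityʳ u))

    generic∈𝒪₁ : ¬ Image w → generic v′ w ∈ 𝒪 (# 1F)
    generic∈𝒪₁ w∉℘ = classify 1F (generic v′ w) (planePoint∉𝒜 nz w) (planePoint⟂U₄ nz w) ≡.refl
      (cardinality-zero _ (λ (t , r) _ → w∉℘ (t * v , trans (sym (℘-root t)) (root⁻¹ nz w r))))

    -- If ℘ u = w, the solutions of ℘ (t v) = w are t = u/v and t = (u+1)/v; with the plane of U₄
    -- they account for three osculating planes.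
    generic∈𝒪₃ : Image w → generic v′ w ∈ 𝒪 (# 3F)
    generic∈𝒪₃ (u , ℘u≈w) = classify 3F (generic v′ w) (planePoint∉𝒜 nz w) (planePoint⟂U₄ nz w) ≡.refl
      (cardinality-two _
        (u * v′ ⁻¹ , solution ℘u≈w)
        ((u + 1#) * v′ ⁻¹ , solution (trans (℘-translate u) ℘u≈w))
        (λ eq → x≉x+1 (trans (sym (unscale u)) (trans (*-congʳ eq) (unscale (u + 1#)))))
        (λ (t , r) → cover t (℘-fibre {u} {t * v} (trans ℘u≈w (trans (sym (root⁻¹ nz w r)) (℘-root t))))))
      where
      solution : ∀ {u} → ℘ u ≈ w → P[ u * v′ ⁻¹ ] ⟂ generic v′ w
      solution {u} ℘u≈w = root nz w (trans (℘-root _) (trans (℘-cong (unscale u)) ℘u≈w))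
      solve-for : ∀ {x} t → x ≈ t * v → x * v′ ⁻¹ ≈ t
      solve-for t x≈tv = trans (*-congʳ x≈tv) (trans (*-assoc _ _ _) (trans (*-congˡ (⁻¹-inverseʳ v′)) (*-identityʳ t)))
      cover : ∀ t → u ≈ t * v ⊎ u + 1# ≈ t * v → u * v′ ⁻¹ ≈ t ⊎ (u + 1#) * v′ ⁻¹ ≈ t
      cover t (inj₁ eq) = inj₁ (solve-for t eq)
      cover t (inj₂ eq) = inj₂ (solve-for t eq)

  -- Normal forms of the points of X₁ = 0

  data Shape (Q : Point) : Set (c ⊔ ℓ) where
    vertex     : U 3F ∼ Q → Shape Q
    on-line₀₁  : ∀ y → line₀₁ y ∼ Q → Shape Q
    on-line₁₀  : ∀ y → line₁₀ y ∼ Q → Shape Q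
    generic-at : ∀ v w → generic v w ∼ Q → Shape Q

  scaled : ∀ P Q k → Nonzero k → (∀ i → coord Q i ≈ k * coord P i) → P ∼ Q
  scaled P Q k k≉0 eq = Pt.sym {Q} {P} (k , k≉0 , eq)

  -- The cases record which of the two middle coordinates vanish; a nonvanishing one allows the
  -- point to be normalised.
  shape : ∀ Q → Q ⟂ U 3F → Shape Q
  shape Q Q⟂U with coord Q 1F ≈? 0# | coord Q 2F ≈? 0#
  ... | yes x₁≈0 | yes x₂≈0 = vertex (scaled (U 3F) Q x₃
      (λ x₃≈0 → nonzero Q (x₀≈0 ∷≈ x₁≈0 ∷≈ x₂≈0 ∷≈ x₃≈0 ∷≈ []≈))
      (trans x₀≈0 (sym (zeroʳ _)) ∷≈ trans x₁≈0 (sym (zeroʳ _)) ∷≈ trans x₂≈0 (sym (zeroʳ _))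
        ∷≈ sym (*-identityʳ _) ∷≈ []≈))
    where
    x₀≈0 = ⟂U₄⇒0 Q Q⟂U
    x₃ = coord Q 3F
  ... | yes x₁≈0 | no x₂≉0 = on-line₀₁ y (scaled (line₀₁ y) Q x₂ x₂≉0
      (trans (⟂U₄⇒0 Q Q⟂U) (sym (zeroʳ _)) ∷≈ trans x₁≈0 (sym (zeroʳ _)) ∷≈ sym (*-identityʳ _)
        ∷≈ sym (*-⁻¹-cancelˡ (x₂ , x₂≉0) (coord Q 3F)) ∷≈ []≈))
    where
    x₂ = coord Q 2F
    y = (x₂ , x₂≉0) ⁻¹ * coord Q 3F
  ... | no x₁≉0 | yes x₂≈0 = on-line₁₀ y (scaled (line₁₀ y) Q x₁ x₁≉0
      (trans (⟂U₄⇒0 Q Q⟂U) (sym (zeroʳ _)) ∷≈ sym (*-identityʳ _) ∷≈ trans x₂≈0 (sym (zeroʳ _))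
        ∷≈ sym (*-⁻¹-cancelˡ (x₁ , x₁≉0) (coord Q 3F)) ∷≈ []≈))
    where
    x₁ = coord Q 1F
    y = (x₁ , x₁≉0) ⁻¹ * coord Q 3F
  ... | no x₁≉0 | no x₂≉0 = generic-at v w (scaled (generic v w) Q k k≉0
      (trans (⟂U₄⇒0 Q Q⟂U) (sym (zeroʳ _)) ∷≈ x₁≈kσv
        ∷≈ x₂≈kv
        ∷≈ sym (*-⁻¹-cancelˡ (k , k≉0) (coord Q 3F)) ∷≈ []≈))
    where
    x₁ = coord Q 1F
    x₂ = coord Q 2F
    -- Writing (x₁,x₂) as k (σ v,v) requires σ v / v = x₁ / x₂, which fixes v; then k = x₂ / v.
    ratio = σ-ratio x₁≉0 x₂≉0
    v : Unit
    v = proj₁ ratio , proj₁ (proj₂ ratio)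
    k = v ⁻¹ * x₂
    k≉0 = *-nonzero (⁻¹-nonzero v) x₂≉0
    w = (k , k≉0) ⁻¹ * coord Q 3F
    x₂≈kv : x₂ ≈ k * proj₁ v
    x₂≈kv = sym (trans (*-comm _ _) (*-⁻¹-cancelˡ v x₂))
    x₁≈kσv : x₁ ≈ k * σ (proj₁ v)
    x₁≈kσv = begin
      x₁                              ≈⟨ *-⁻¹-cancelˡ v x₁ ⟨
      proj₁ v * (v ⁻¹ * x₁)           ≈⟨ solve 3 (λ a b c → a :* (b :* c) := b :* (c :* a)) refl (proj₁ v) (v ⁻¹) x₁ ⟩
      v ⁻¹ * (x₁ * proj₁ v)           ≈⟨ *-congˡ (proj₂ (proj₂ ratio)) ⟨
      v ⁻¹ * (σ (proj₁ v) * x₂)       ≈⟨ solve 3 (λ a b c → a :* (b :* c) := a :* c :* b) refl (v ⁻¹) (σ (proj₁ v)) x₂ ⟩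
      k * σ (proj₁ v)                 ∎

  unscaled : ∀ {x y k} → k ≈ 1# → x ≈ k * y → x ≈ y
  unscaled k≈1 eq = trans eq (trans (*-congʳ k≈1) (*-identityˡ _))

  k≈1 : ∀ {k} → 1# ≈ k * 1# → k ≈ 1#
  k≈1 eq = trans (sym (*-identityʳ _)) (sym eq)

  -- The third coordinate gives u = k v and the second σ u = k σ v, so σ (k v) = k σ v and the
  -- scalar is 1.
  generic-injective : ∀ u v {w z} → generic u w ∼ generic v z → proj₁ u ≈ proj₁ v × w ≈ z
  generic-injective (u , _) (v , v≉0) (k , k≉0 , eq) = unscaled one (eq 2F) , unscaled one (eq 3F)
    where
    one : k ≈ 1#
    one = σ-homogeneous⇒1 k≉0 v≉0 (trans (σ-cong (sym (eq 2F))) (eq 1F))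

  generic-cong : ∀ u v {w z} → proj₁ u ≈ proj₁ v → w ≈ z → generic u w ∼ generic v z
  generic-cong u v {w} {z} u≈v w≈z = ≈⇒∼ (generic u w) (generic v z) (refl ∷≈ σ-cong u≈v ∷≈ u≈v ∷≈ w≈z ∷≈ []≈)

  -- Sizes of the classes on the plane X₁ = 0

  separated : ∀ d d′ → ¬ (d ≡ d′) → ∀ P Q → P ∈ 𝒪 d → P ∼ Q → Q ∉ 𝒪 d′
  separated d d′ d≢d′ P Q P∈d P∼Q Q∈d′ = d≢d′ (𝒪-disjoint d d′ Q (𝒪-resp d P Q P∼Q P∈d) Q∈d′)

  module GenericClass {p} {W : Pred Carrier p} (i : Fin 4) (member : ∀ v {w} → W w → generic v w ∈ 𝒪 (# i))
    (cover : ∀ Q → Q ∈ 𝒪 (# i) → Shape Q → ∃ λ v → ∃ λ w → W w × generic v w ∼ Q) where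

    -- Classes 1 and 3 differ only in the condition `W` on w. Since v ranges freely over the units,
    -- the size is a product.
    genericClass : Inverse (×-setoid unitSetoid (subset setoid W)) (Conjugates (𝒪 (# i)) (U 3F))
    genericClass = bijective⇒Inverse _ _
      (λ (v , w , w∈W) → generic v w , member v w∈W , planePoint⟂U₄ (σv,v≉0 v) w)
      (λ {(u , _)} {(v , _)} (u≈v , w≈z) → generic-cong u v u≈v w≈z)
      (λ {(u , _)} {(v , _)} → generic-injective u v)
      (λ (Q , Q∈ , Q⟂U) → let v , w , w∈W , eq = cover Q Q∈ (shape Q Q⟂U) in (v , w , w∈W) , eq)

  U₄∈𝒜 : U 3F ∈ 𝒜
  U₄∈𝒜 = inj₂ (Pt.refl {U 3F})

  -- Every other normal form has a known class different from 1, and disjointness excludes it.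
  cover₁ : ∀ Q → Q ∈ 𝒪 (# 1F) → Shape Q → ∃ λ v → ∃ λ w → ¬ Image w × generic v w ∼ Q
  cover₁ Q Q∈ (vertex eq) = ⊥-elim (separated q+1 (# 1F) (λ ()) (U 3F) Q U₄∈𝒜 eq Q∈)
  cover₁ Q Q∈ (on-line₀₁ y eq) = ⊥-elim (separated (# 2F) (# 1F) (λ ()) (line₀₁ y) Q (line₀₁∈𝒪₂ y) eq Q∈)
  cover₁ Q Q∈ (on-line₁₀ y eq) = ⊥-elim (separated (# 2F) (# 1F) (λ ()) (line₁₀ y) Q (line₁₀∈𝒪₂ y) eq Q∈)
  cover₁ Q Q∈ (generic-at v w eq) with Image? w
  ... | no  w∉℘ = v , w , w∉℘ , eq
  ... | yes w∈℘ = ⊥-elim (separated (# 3F) (# 1F) (λ ()) (generic v w) Q (generic∈𝒪₃ v w w∈℘) eq Q∈)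

  cover₃ : ∀ Q → Q ∈ 𝒪 (# 3F) → Shape Q → ∃ λ v → ∃ λ w → Image w × generic v w ∼ Q
  cover₃ Q Q∈ (vertex eq) = ⊥-elim (separated q+1 (# 3F) (λ ()) (U 3F) Q U₄∈𝒜 eq Q∈)
  cover₃ Q Q∈ (on-line₀₁ y eq) = ⊥-elim (separated (# 2F) (# 3F) (λ ()) (line₀₁ y) Q (line₀₁∈𝒪₂ y) eq Q∈)
  cover₃ Q Q∈ (on-line₁₀ y eq) = ⊥-elim (separated (# 2F) (# 3F) (λ ()) (line₁₀ y) Q (line₁₀∈𝒪₂ y) eq Q∈)
  cover₃ Q Q∈ (generic-at v w eq) with Image? w
  ... | yes w∈℘ = v , w , w∈℘ , eq
  ... | no  w∉℘ = ⊥-elim (separated (# 1F) (# 3F) (λ ()) (generic v w) Q (generic∈𝒪₁ v w w∉℘) eq Q∈)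

  lines : Carrier ⊎ Carrier → Point
  lines (inj₁ y) = line₀₁ y
  lines (inj₂ y) = line₁₀ y

  lines∈𝒪₂ : ∀ x → lines x ∈ 𝒪 (# 2F)
  lines∈𝒪₂ (inj₁ y) = line₀₁∈𝒪₂ y
  lines∈𝒪₂ (inj₂ y) = line₁₀∈𝒪₂ y

  lines⟂U₄ : ∀ x → lines x ⟂ U 3F
  lines⟂U₄ (inj₁ y) = planePoint⟂U₄ 01≉0 y
  lines⟂U₄ (inj₂ y) = planePoint⟂U₄ 10≉0 y

  cover₂ : ∀ Q → Q ∈ 𝒪 (# 2F) → Shape Q → ∃ λ x → lines x ∼ Q
  cover₂ Q Q∈ (vertex eq) = ⊥-elim (separated q+1 (# 2F) (λ ()) (U 3F) Q U₄∈𝒜 eq Q∈)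
  cover₂ Q Q∈ (on-line₀₁ y eq) = inj₁ y , eq
  cover₂ Q Q∈ (on-line₁₀ y eq) = inj₂ y , eq
  cover₂ Q Q∈ (generic-at v w eq) with Image? w
  ... | yes w∈℘ = ⊥-elim (separated (# 3F) (# 2F) (λ ()) (generic v w) Q (generic∈𝒪₃ v w w∈℘) eq Q∈)
  ... | no  w∉℘ = ⊥-elim (separated (# 1F) (# 2F) (λ ()) (generic v w) Q (generic∈𝒪₁ v w w∉℘) eq Q∈)

  linesClass : Inverse (⊎-setoid setoid setoid) (Conjugates (𝒪 (# 2F)) (U 3F))
  linesClass = bijective⇒Inverse _ _ (λ x → lines x , lines∈𝒪₂ x , lines⟂U₄ x)
    (λ {x} {y} → lines-cong {x} {y}) (λ {x} {y} → lines-injective {x} {y})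
    (λ (Q , Q∈ , Q⟂U) → cover₂ Q Q∈ (shape Q Q⟂U))
    where
    lines-cong : ∀ {x y} → Setoid._≈_ (⊎-setoid setoid setoid) x y → lines x ∼ lines y
    lines-cong (⊎.inj₁ {y} {z} y≈z) = ≈⇒∼ (line₀₁ y) (line₀₁ z) (refl ∷≈ refl ∷≈ refl ∷≈ y≈z ∷≈ []≈)
    lines-cong (⊎.inj₂ {y} {z} y≈z) = ≈⇒∼ (line₁₀ y) (line₁₀ z) (refl ∷≈ refl ∷≈ refl ∷≈ y≈z ∷≈ []≈)
    lines-injective : ∀ {x y} → lines x ∼ lines y → Setoid._≈_ (⊎-setoid setoid setoid) x y
    lines-injective {inj₁ _} {inj₁ _} (k , _ , eq) = ⊎.inj₁ (unscaled (k≈1 (eq 2F)) (eq 3F))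
    lines-injective {inj₂ _} {inj₂ _} (k , _ , eq) = ⊎.inj₂ (unscaled (k≈1 (eq 1F)) (eq 3F))
    lines-injective {inj₁ _} {inj₂ _} (k , _ , eq) = ⊥-elim (1≉0 (trans (eq 2F) (zeroʳ k)))
    lines-injective {inj₂ _} {inj₁ _} (k , _ , eq) = ⊥-elim (1≉0 (trans (eq 1F) (zeroʳ k)))

  count : ∀ d → HasCardinality (Conjugates (𝒪 d) (U 3F)) (r[q+1, d ] (2 ℕ.^ n))
  count q+1 = cardinality-one _ (U 3F , U₄∈𝒜 , ⟂U₄ (U 3F) refl) unique
    where
    unique : ∀ ((Q , _) : ∃ λ Q → 𝒜 Q × Q ⟂ U 3F) → U 3F ∼ Q
    unique (Q , inj₂ Q∼U , _) = Pt.sym {Q} {U 3F} Q∼U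
    -- A multiple of P_t has nonzero first coordinate and so is off the plane X₁ = 0.
    unique (Q , inj₁ (t , k , k≉0 , eq) , Q⟂U) =
      ⊥-elim (k≉0 (trans (sym (*-identityʳ k)) (trans (sym (eq 0F)) (⟂U₄⇒0 Q Q⟂U))))
  -- A point conjugate to U₄ lies on the osculating plane U₄^𝔰, so it cannot lie on none.
  count (# 0F) = cardinality-zero _ (λ (Q , (_ , J) , Q⟂U) _ →
    cardinality-zero⇒empty (Inv.trans (osculating Q) J) (U 3F , U₄∈𝒜 , ⟂-sym Q (U 3F) Q⟂U))
  count (# 1F) = let m , m*2≡q , _ , J = halves in
    ≡.subst (HasCardinality _) (half-product m*2≡q)
      (Inv.trans (Inv.sym (GenericClass.genericClass 1F (λ v {w} → generic∈𝒪₁ v w) cover₁)) (cardinality-× units-cardinality J))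
  -- The two lines X₁ = X₂ = 0 and X₁ = X₃ = 0 contribute q points each besides U₄; `2 * q` unfolds
  -- to q + (q + 0), whence the rewriting.
  count (# 2F) = ≡.subst (HasCardinality _) (≡.cong (2 ℕ.^ n ℕ.+_) (≡.sym (ℕ.+-identityʳ (2 ℕ.^ n))))
    (Inv.trans (Inv.sym linesClass) (cardinality-⊎ I I))
  count (# 3F) = let m , m*2≡q , J , _ = halves in
    ≡.subst (HasCardinality _) (half-product m*2≡q)
      (Inv.trans (Inv.sym (GenericClass.genericClass 3F (λ v {w} → generic∈𝒪₃ v w) cover₃)) (cardinality-× units-cardinality J))

  exactly : ∀ P → P ∈ 𝒜 → ∀ d → Exactly r[q+1, d ] (2 ℕ.^ n) PlanesOf (𝒪 d ˢ) Through P
  exactly P P∈𝒜 d = Inv.trans (Inv.sym (conjugates↔planes (𝒪-resp d) P)) (Inv.trans (homogeneous d P P∈𝒜) (count d))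

open import Data.Nat using (_^_)

proposition3p7 : ∀ {c ℓ} (n h : ℕ) → 3 ≤ n → 1 ≤ h → gcd n h ≡ 1 →
  (K : Field c ℓ) → HasCardinality (Field.setoid K) (2 ^ n) →
  let open PG3 K
      open Arc h
  in (P : Point) → P ∈ 𝒜 → (d : Class) →
     Exactly r[q+1, d ] (2 ^ n) PlanesOf (𝒪 d ˢ) Through P
proposition3p7 n h _ _ coprime K I = Counting.exactly K {n} {h} I coprime
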